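{- For every fixed $\delta\in(0,1]$, there is an algorithm that, given an instance of Restricted Assignment with $n$ jobs and $m$ machines and a (possibly infeasible) predicted assignment $\hat\pi:[n]\to[m]$, runs in time $(nm)^{O(1/\delta)}$ and outputs a feasible schedule $\sigma$ with $$C_{\max}(\sigma)\le \mathrm{OPT}+\delta\,\mathcal{E}.$$
   Context: Restricted Assignment: there are $n$ jobs and $m$ machines. Each job $j\in[n]$ has an integer processing time $p_j\in\mathbb{Z}_{\ge 1}$ and a nonempty set $\Gamma(j)\subseteq[m]$ of eligible machines. A schedule $\sigma:[n]\to[m]$ is feasible if $\sigma(j)\in\Gamma(j)$ for all $j$. Write $L_i(\sigma)=\sum_{j:\sigma(j)=i}p_j$, $C_{\max}(\sigma)=\max_{i\in[m]}L_i(\sigma)$, and $\mathrm{OPT}=\min\{C_{\max}(\sigma):\sigma\text{ feasible}\}$. Prediction: a map $\hat\pi:[n]\to[m]$, possibly infeasible (i.e. $\hat\pi(j)\notin\Gamma(j)$ for some $j$). For a feasible schedule $\sigma$ and any map $\tau:[n]\to[m]$, the moved-load is $\mathrm{move}(\sigma,\tau)=\sum_{j:\sigma(j)\ne\tau(j)}p_j$. The prediction error is $\mathcal{E}=\min\{\mathrm{move}(\sigma^*,\hat\pi):\sigma^*\text{ feasible and }C_{\max}(\sigma^*)=\mathrm{OPT}\}$; it is not known to the algorithm. -}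

module Defs where

open import Algebra.Properties.CommutativeMonoid.Sum using (sum; sum-cong-≗)
open import Data.Bool.Base using (if_then_else_)
open import Data.Fin.Base using (Fin; zero; suc; toℕ; fromℕ<; remQuot; finToFun; funToFin)
open import Data.Fin.Properties as Fin using (all?; any?; finToFun-funToFin)
open import Data.Fin.Subset using (Subset; Nonempty) renaming (_∈_ to _∈ˢ_)
open import Data.Fin.Subset.Properties using (_∈?_)
import Data.Integer.Base as ℤ
open import Data.Nat.Base using (ℕ; zero; suc; _+_; _*_; _∸_; _⊔_; _≤_; _<_)
open import Data.Nat.Induction using (<-rec)
open import Data.Nat.Properties as ℕ using (+-0-commutativeMonoid)
open import Data.Product.Base using (∃; _×_; _,_; proj₁; proj₂; uncurry)
open import Data.Rational.Base as ℚ using (ℚ; 0ℚ; 1ℚ)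
open import Data.Sum.Base using (_⊎_)
open import Data.Vec.Functional as Vector using ()
open import Function.Base using (_∘_)
open import Function.Bundles using (_⇔_)
open import Level using (0ℓ)
open import Relation.Binary.PropositionalEquality
  using (_≡_; _≢_; _≗_; refl; sym; trans; cong; cong₂; subst)
open import Relation.Nullary using (¬_; Dec; yes; no; does)
open import Relation.Nullary.Decidable using (_×-dec_; map′)
open import Relation.Unary using (Pred; Decidable)

------------------------------------------------------------------------
-- Restricted Assignment

record Instance (n m : ℕ) : Set where
  field
    p          : Fin n → ℕ
    p≥1        : ∀ j → 1 ≤ p j
    Γ          : Fin n → Subset m
    Γ-nonempty : ∀ j → Nonempty (Γ j)

Assignment : ℕ → ℕ → Set
Assignment n m = Fin n → Fin m

Σℕ : ∀ {n} → (Fin n → ℕ) → ℕ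
Σℕ = sum +-0-commutativeMonoid

-- The empty maximum is 0; it only occurs for m = 0, which forces n = 0.
Max : ∀ {n} → (Fin n → ℕ) → ℕ
Max = Vector.foldr _⊔_ 0

IsMinimum : Pred ℕ 0ℓ → Pred ℕ 0ℓ
IsMinimum P k = P k × (∀ l → P l → k ≤ l)

minimum : (P : Pred ℕ 0ℓ) → Decidable P → ∃ P → ∃ (IsMinimum P)
minimum P P? (k , Pk) = <-rec (λ k → P k → ∃ (IsMinimum P)) step k Pk
  where
  step : ∀ k → (∀ {l} → l < k → P l → ∃ (IsMinimum P)) → P k → ∃ (IsMinimum P)
  step k rec Pk with ℕ.anyUpTo? P? k
  ... | yes (l , l<k , Pl) = rec l<k Pl
  ... | no ¬smaller = k , Pk , λ l Pl → ℕ.≮⇒≥ λ l<k → ¬smaller (l , l<k , Pl)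

anyAssignment? : ∀ {n m} {P : Pred (Assignment n m) 0ℓ} →
  (∀ {σ τ} → σ ≗ τ → P σ → P τ) → Decidable P → Dec (∃ P)
anyAssignment? resp P? = map′
  (λ (k , Pk) → finToFun k , Pk)
  (λ (σ , Pσ) → funToFin σ , resp (sym ∘ finToFun-funToFin σ) Pσ)
  (any? (P? ∘ finToFun))

module _ {n m : ℕ} (I : Instance n m) where
  open Instance I

  Feasible : Pred (Assignment n m) 0ℓ
  Feasible σ = ∀ j → σ j ∈ˢ Γ j

  load : Assignment n m → Fin m → ℕ
  load σ i = Σℕ λ j → if does (σ j Fin.≟ i) then p j else 0

  Cmax : Assignment n m → ℕ
  Cmax σ = Max (load σ)

  move : Assignment n m → Assignment n m → ℕ
  move σ τ = Σℕ λ j → if does (σ j Fin.≟ τ j) then 0 else p j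

  -- The values over which OPT and the prediction error are minima.

  Makespan : Pred ℕ 0ℓ
  Makespan k = ∃ λ σ → Feasible σ × Cmax σ ≡ k

  private
    Max-cong : ∀ {k} {f g : Fin k → ℕ} → f ≗ g → Max f ≡ Max g
    Max-cong {zero}  eq = refl
    Max-cong {suc k} eq = cong₂ _⊔_ (eq zero) (Max-cong (eq ∘ suc))

  Cmax-cong : ∀ {σ τ} → σ ≗ τ → Cmax σ ≡ Cmax τ
  Cmax-cong eq = Max-cong λ i → sum-cong-≗ +-0-commutativeMonoid λ j →
    cong (λ x → if does (x Fin.≟ i) then p j else 0) (eq j)

  move-congˡ : ∀ {σ τ} ρ → σ ≗ τ → move σ ρ ≡ move τ ρ
  move-congˡ ρ eq = sum-cong-≗ +-0-commutativeMonoid λ j →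
    cong (λ x → if does (x Fin.≟ ρ j) then 0 else p j) (eq j)

  Feasible-resp : ∀ {σ τ} → σ ≗ τ → Feasible σ → Feasible τ
  Feasible-resp eq f j = subst (_∈ˢ Γ j) (eq j) (f j)

  feasible? : Decidable Feasible
  feasible? σ = all? λ j → σ j ∈? Γ j

  makespan? : Decidable Makespan
  makespan? k = anyAssignment?
    (λ eq (f , c) → Feasible-resp eq f , trans (sym (Cmax-cong eq)) c)
    (λ σ → feasible? σ ×-dec (Cmax σ ℕ.≟ k))

  opt-exists : ∃ (IsMinimum Makespan)
  opt-exists = minimum Makespan makespan?
    (_ , proj₁ ∘ Γ-nonempty , proj₂ ∘ Γ-nonempty , refl)

  OPT : ℕ
  OPT = proj₁ opt-exists

  OptimalMove : Assignment n m → Pred ℕ 0ℓ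
  OptimalMove π̂ k = ∃ λ σ → (Feasible σ × Cmax σ ≡ OPT) × move σ π̂ ≡ k

  optimalMove? : ∀ π̂ → Decidable (OptimalMove π̂)
  optimalMove? π̂ k = anyAssignment?
    (λ eq ((f , c) , d) →
      (Feasible-resp eq f , trans (sym (Cmax-cong eq)) c) ,
      trans (sym (move-congˡ π̂ eq)) d)
    (λ σ → (feasible? σ ×-dec (Cmax σ ℕ.≟ OPT)) ×-dec (move σ π̂ ℕ.≟ k))

  error-exists : ∀ π̂ → ∃ (IsMinimum (OptimalMove π̂))
  error-exists π̂ = minimum (OptimalMove π̂) (optimalMove? π̂)
    (_ , proj₁ (proj₁ (proj₂ opt-exists)) , proj₂ (proj₁ (proj₂ opt-exists)) , refl)

  PredictionError : Assignment n m → ℕ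
  PredictionError π̂ = proj₁ (error-exists π̂)

------------------------------------------------------------------------
-- Real numbers, as two-sided Dedekind cuts

record ℝ : Set₁ where
  field
    -- lower q means q < x and upper q means x < q, for the real x.
    lower upper     : Pred ℚ 0ℓ
    lower-inhabited : ∃ lower
    upper-inhabited : ∃ upper
    lower-rounded   : ∀ q → lower q ⇔ (∃ λ r → q ℚ.< r × lower r)
    upper-rounded   : ∀ q → upper q ⇔ (∃ λ r → r ℚ.< q × upper r)
    disjoint        : ∀ q → ¬ (lower q × upper q)
    located         : ∀ q r → q ℚ.< r → lower q ⊎ upper r

open ℝ

fromℕ : ℕ → ℚ
fromℕ k = ℤ.+ k ℚ./ 1

-- 0 < x ≤ 1
Unit : Pred ℝ 0ℓ
Unit x = lower x 0ℚ × ¬ lower x 1ℚ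

-- a · x ≤ b
Scaled≤ : ℕ → ℝ → ℕ → Set
Scaled≤ a x b = ∀ q → lower x q → fromℕ a ℚ.* q ℚ.≤ fromℕ b

-- a ≤ b + x · c.  Since c ≥ 0, b + x · c is the infimum of b + q · c over
-- the rationals q > x.
≤Affine : ℕ → ℕ → ℝ → ℕ → Set
≤Affine a b x c = ∀ q → upper x q → fromℕ a ℚ.≤ fromℕ b ℚ.+ q ℚ.* fromℕ c

------------------------------------------------------------------------
-- Machine model: structured programs on a unit-cost random access memory.
--
-- The memory consists of named arrays of unbounded natural numbers; a
-- program mentions only finitely many names, so these are equivalent, up to
-- a constant factor, to one interleaved array.  As in Cook and Reckhow's
-- RAM, the arithmetic is addition and (truncated) subtraction only: with
-- unit-cost multiplication, numbers of exponential length could be built in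
-- polynomial time.

Name : Set
Name = ℕ

Memory : Set
Memory = Name → ℕ → ℕ

infixl 6 _⊕_ _⊖_
infix  8 _[_]

data Exp : Set where
  lit     : ℕ → Exp
  _[_]    : Name → Exp → Exp
  _⊕_ _⊖_ : Exp → Exp → Exp

eval : Memory → Exp → ℕ
eval s (lit k)   = k
eval s (a [ e ]) = s a (eval s e)
eval s (e ⊕ f)   = eval s e + eval s f
eval s (e ⊖ f)   = eval s e ∸ eval s f

-- One unit of time per operation.
cost : Exp → ℕ
cost (lit k)   = 1
cost (a [ e ]) = suc (cost e)
cost (e ⊕ f)   = suc (cost e + cost f)
cost (e ⊖ f)   = suc (cost e + cost f)

infix  5 _[_]≔_
infixr 4 _⨾_

data Program : Set where
  skip            : Program
  _[_]≔_          : Name → Exp → Exp → Program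
  _⨾_             : Program → Program → Program
  ifNZ_then_else_ : Exp → Program → Program → Program
  whileNZ_loop_   : Exp → Program → Program

write : Memory → Name → ℕ → ℕ → Memory
write s a k v b l =
  if does (b ℕ.≟ a) then (if does (l ℕ.≟ k) then v else s b l) else s b l

-- c , s ⇓[ t ] s′ : started in memory s, program c halts after t units of
-- time in memory s′.
infix 3 _,_⇓[_]_

data _,_⇓[_]_ : Program → Memory → ℕ → Memory → Set where
  skip : ∀ {s} →
    skip , s ⇓[ 1 ] s
  assign : ∀ {s a e f} →
    a [ e ]≔ f , s ⇓[ suc (cost e + cost f) ] write s a (eval s e) (eval s f)
  seq : ∀ {c d s s′ s″ t u} →
    c , s ⇓[ t ] s′ → d , s′ ⇓[ u ] s″ →
    c ⨾ d , s ⇓[ t + u ] s″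
  if-true : ∀ {e c d s s′ t} →
    eval s e ≢ 0 → c , s ⇓[ t ] s′ →
    ifNZ e then c else d , s ⇓[ suc (cost e + t) ] s′
  if-false : ∀ {e c d s s′ t} →
    eval s e ≡ 0 → d , s ⇓[ t ] s′ →
    ifNZ e then c else d , s ⇓[ suc (cost e + t) ] s′
  while-true : ∀ {e c s s′ s″ t u} →
    eval s e ≢ 0 → c , s ⇓[ t ] s′ → whileNZ e loop c , s′ ⇓[ u ] s″ →
    whileNZ e loop c , s ⇓[ suc (cost e + (t + u)) ] s″
  while-false : ∀ {e c s} →
    eval s e ≡ 0 →
    whileNZ e loop c , s ⇓[ suc (cost e) ] s

------------------------------------------------------------------------
-- Input and output conventions

nᴬ mᴬ pᴬ Γᴬ πᴬ outᴬ : Name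
nᴬ   = 0
mᴬ   = 1
pᴬ   = 2
Γᴬ   = 3
πᴬ   = 4
outᴬ = 5

-- The array holding f, padded with zeros.
array : ∀ {k} → (Fin k → ℕ) → ℕ → ℕ
array {k} f l with l ℕ.<? k
... | yes l<k = f (fromℕ< l<k)
... | no  _   = 0

-- Γ is stored as a 0/1 matrix in row-major order: the entry for job j and
-- machine i is at index m * j + i.
input : ∀ {n m} → Instance n m → Assignment n m → Memory
input {n} {m} I π̂ 0 = array {1} λ _ → n
input {n} {m} I π̂ 1 = array {1} λ _ → m
input {n} {m} I π̂ 2 = array (Instance.p I)
input {n} {m} I π̂ 3 = array {n * m} λ k →
  uncurry (λ j i → if does (i ∈? Instance.Γ I j) then 1 else 0) (remQuot {n} m k)
input {n} {m} I π̂ 4 = array (toℕ ∘ π̂)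
input {n} {m} I π̂ _ = λ _ → 0

Outputs : ∀ {n m} → Memory → Assignment n m → Set
Outputs s σ = ∀ j → s outᴬ (toℕ j) ≡ toℕ (σ j)

{-# OPTIONS --safe #-}

-- Let σ* be an optimal schedule with move(σ*, π̂) = E and let K ≥ 2/δ.  At most
-- K jobs with K p > E are moved; the algorithm guesses them with their
-- machines, leaves the other large jobs where π̂ has them, and has to place the
-- jobs with p ≤ θ, where θ is the largest processing time with K θ ≤ E.  Any
-- placement has makespan between OPT and OPT + n θ, so some T = L ∸ k θ with
-- k ≤ n lies between OPT and OPT + θ.  For such a T, push–relabel moves a small
-- job from a machine of load above T + θ to a machine of smaller label, and
-- relabels if there is no such job.  Machines of load at most T keep label 0.
-- Since T ≥ OPT, no label reaches m: above an empty level the labels would cut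
-- off machines that all have load above T and whose jobs no schedule that
-- agrees with σ* on the large jobs can process elsewhere.  So after
-- O(n m²) steps all loads are at most T + θ ≤ OPT + 2 θ ≤ OPT + δ E.

module Submission where

open import Defs
open import Algebra.Properties.CommutativeMonoid.Sum using (∑-distrib-+; ∑-comm; sum-cong-≗)
open import Data.Empty using (⊥)
open import Data.Bool.Base using (Bool; true; false; not; _∧_; _∨_; if_then_else_)
open import Data.Fin.Base as Fin
  using (Fin; zero; suc; toℕ; fromℕ<; inject₁; combine; remQuot)
import Data.Fin.Properties as Fin
open import Data.Fin.Subset using () renaming (_∈_ to _∈ˢ_)
open import Data.Fin.Subset.Properties using (_∈?_)
import Data.Integer.Base as ℤ
import Data.Integer.Properties as ℤ
open import Data.Nat.Base
open import Data.Nat.Properties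
open import Data.Nat.Solver using (module +-*-Solver)
open import Data.Product.Base using (Σ; ∃; _×_; _,_; proj₁; proj₂; uncurry)
open import Data.Rational.Base as ℚ using (ℚ; mkℚ; 0ℚ; 1ℚ; toℚᵘ)
import Data.Rational.Properties as ℚ
open import Data.Rational.Unnormalised.Base using (mkℚᵘ; *≤*; *<*) renaming (_≃_ to _≃ᵘ_)
import Data.Rational.Unnormalised.Properties as ℚᵘ
open import Data.Sum.Base using (_⊎_; inj₁; inj₂)
open import Data.Vec.Functional using (updateAt)
open import Data.Vec.Functional.Properties using (updateAt-updates; updateAt-minimal)
open import Function.Base using (case_of_; _∘_; const)
open import Function.Bundles using (Equivalence)
open import Relation.Binary.Definitions using (tri<; tri≈; tri>)
open import Relation.Binary.PropositionalEquality hiding ([_])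
open import Relation.Nullary using (¬_; Dec; yes; no; does; contradiction)
open import Relation.Nullary.Decidable using (dec-true; dec-false; ¬?; decidable-stable)

open +-*-Solver using (solve; con; _:=_; _:+_; _:*_)

-- A language of bounded loops

-- A loop bound is fixed by n and m alone, so iteration counts are polynomial.
data Range : Set where
  one jobs machines : Range
  _∔_ : Range → Range → Range

⌜_⌝ : Range → Exp
⌜ one ⌝      = lit 1
⌜ jobs ⌝     = nᴬ [ lit 0 ]
⌜ machines ⌝ = mᴬ [ lit 0 ]
⌜ r ∔ r′ ⌝   = ⌜ r ⌝ ⊕ ⌜ r′ ⌝

size : Range → ℕ → ℕ → ℕ
size one n m      = 1
size jobs n m     = n
size machines n m = m
size (r ∔ r′) n m = size r n m + size r′ n m

infix  5 _[_]:=_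
infixr 4 _⨟_
infix  5 when_then_otherwise_ for_below_repeat_

data Cmd : Set where
  nop                   : Cmd
  _[_]:=_               : Name → Exp → Exp → Cmd
  _⨟_                   : Cmd → Cmd → Cmd
  when_then_otherwise_  : Exp → Cmd → Cmd → Cmd
  for_below_repeat_         : Name → Range → Cmd → Cmd

compile : Cmd → Program
compile nop                      = skip
compile (a [ e ]:= f)            = a [ e ]≔ f
compile (c ⨟ d)                  = compile c ⨾ compile d
compile (when e then c otherwise d) = ifNZ e then compile c else compile d
compile (for x below r repeat c)     =
  x [ lit 0 ]≔ ⌜ r ⌝ ⨾
  whileNZ x [ lit 0 ] loop (x [ lit 0 ]≔ x [ lit 0 ] ⊖ lit 1 ⨾ compile c)

branch : ∀ {A : Set} → ℕ → A → A → A
branch zero    x y = y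
branch (suc _) x y = x

countdown : (Memory → Memory) → Name → ℕ → Memory → Memory
countdown f x zero    s = s
countdown f x (suc k) s = countdown f x k (f (write s x 0 k))

run : Cmd → Memory → Memory
run nop s                         = s
run (a [ e ]:= f) s               = write s a (eval s e) (eval s f)
run (c ⨟ d) s                     = run d (run c s)
run (when e then c otherwise d) s = branch (eval s e) (run c s) (run d s)
run (for x below r repeat c) s        =
  countdown (run c) x (eval s ⌜ r ⌝) (write s x 0 (eval s ⌜ r ⌝))

writes : Cmd → Name → Bool
writes nop b                         = false
writes (a [ e ]:= f) b               = does (b ≟ a)
writes (c ⨟ d) b                     = writes c b ∨ writes d b
writes (when e then c otherwise d) b = writes c b ∨ writes d b
writes (for x below r repeat c) b        = does (b ≟ x) ∨ writes c b

Keeps : Name → (Memory → Memory) → Set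
Keeps b f = ∀ s l → f s b l ≡ s b l

∨-falseˡ : ∀ x {y} → x ∨ y ≡ false → x ≡ false
∨-falseˡ false _ = refl

∨-falseʳ : ∀ x {y} → x ∨ y ≡ false → y ≡ false
∨-falseʳ false eq = eq

write-other : ∀ s a k v b l → does (b ≟ a) ≡ false → write s a k v b l ≡ s b l
write-other s a k v b l eq rewrite eq = refl

write-case : ∀ (P : ℕ → Set) s a k v l →
  (l ≡ k → P v) → (l ≢ k → P (s a l)) → P (write s a k v a l)
write-case P s a k v l P= P≠ rewrite dec-true (a ≟ a) refl with l ≟ k
... | yes l≡k rewrite dec-true (l ≟ k) l≡k = P= l≡k
... | no  l≢k rewrite dec-false (l ≟ k) l≢k = P≠ l≢k

write-same : ∀ s a k v → write s a k v a k ≡ v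
write-same s a k v = write-case (_≡ v) s a k v k (λ _ → refl) λ k≢k → contradiction refl k≢k

countdown-keeps : ∀ {f x b} → Keeps b f → does (b ≟ x) ≡ false →
  ∀ k → Keeps b (countdown f x k)
countdown-keeps keeps ≠ zero s l = refl
countdown-keeps {f} {x} {b} keeps ≠ (suc k) s l =
  trans (countdown-keeps {f} {x} {b} keeps ≠ k (f (write s x 0 k)) l)
  (trans (keeps (write s x 0 k) l) (write-other s x 0 k b l ≠))

run-keeps : ∀ c b → writes c b ≡ false → Keeps b (run c)
run-keeps nop b eq s l = refl
run-keeps (a [ e ]:= f) b eq s l = write-other s a (eval s e) (eval s f) b l eq
run-keeps (c ⨟ d) b eq s l =
  trans (run-keeps d b (∨-falseʳ (writes c b) eq) (run c s) l)
        (run-keeps c b (∨-falseˡ (writes c b) eq) s l)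
run-keeps (when e then c otherwise d) b eq s l with eval s e
... | zero  = run-keeps d b (∨-falseʳ (writes c b) eq) s l
... | suc _ = run-keeps c b (∨-falseˡ (writes c b) eq) s l
run-keeps (for x below r repeat c) b eq s l =
  trans (countdown-keeps {run c} {x} {b}
          (run-keeps c b (∨-falseʳ (does (b ≟ x)) eq)) ≠x (eval s ⌜ r ⌝) s₁ l)
        (write-other s x 0 _ b l ≠x)
  where
  ≠x = ∨-falseˡ (does (b ≟ x)) eq
  s₁ = write s x 0 (eval s ⌜ r ⌝)

-- Names up to 4 hold the input.
wellFormed : Cmd → Bool
wellFormed nop                         = true
wellFormed (a [ e ]:= f)               = 4 <ᵇ a
wellFormed (c ⨟ d)                     = wellFormed c ∧ wellFormed d
wellFormed (when e then c otherwise d) = wellFormed c ∧ wellFormed d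
wellFormed (for x below r repeat c)        =
  (4 <ᵇ x) ∧ (not (writes c x) ∧ wellFormed c)

rangeDegree : Range → ℕ
rangeDegree (r ∔ r′) = suc (rangeDegree r + rangeDegree r′)
rangeDegree _        = 1

degree : Cmd → ℕ
degree nop                         = 0
degree (a [ e ]:= f)               = suc (cost e + cost f)
degree (c ⨟ d)                     = suc (degree c + degree d)
degree (when e then c otherwise d) = suc (suc (cost e) + (degree c + degree d))
degree (for x below r repeat c)        =
  suc (suc (1 + cost ⌜ r ⌝) + suc (3 + (rangeDegree r + suc (9 + degree c))))

∧-splitˡ : ∀ x {y} → x ∧ y ≡ true → x ≡ true
∧-splitˡ true _ = refl

∧-splitʳ : ∀ x {y} → x ∧ y ≡ true → y ≡ true
∧-splitʳ true eq = eq

∧-join : ∀ {x y} → x ≡ true → y ≡ true → x ∧ y ≡ true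
∧-join refl refl = refl

∨-join : ∀ {x y} → x ≡ false → y ≡ false → x ∨ y ≡ false
∨-join refl refl = refl

not-true : ∀ x → not x ≡ true → x ≡ false
not-true false _ = refl

input≠ : ∀ b a → (4 <ᵇ b) ≡ false → (4 <ᵇ a) ≡ true → does (b ≟ a) ≡ false
input≠ b a b≤4 4<a = dec-false (b ≟ a) λ { refl → case trans (sym b≤4) 4<a of λ () }

input-kept : ∀ c b → wellFormed c ≡ true → (4 <ᵇ b) ≡ false → writes c b ≡ false
input-kept nop b wf b≤4 = refl
input-kept (a [ e ]:= f) b wf b≤4 = input≠ b a b≤4 wf
input-kept (c ⨟ d) b wf b≤4 = ∨-join
  (input-kept c b (∧-splitˡ (wellFormed c) wf) b≤4)
  (input-kept d b (∧-splitʳ (wellFormed c) wf) b≤4)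
input-kept (when e then c otherwise d) b wf b≤4 = ∨-join
  (input-kept c b (∧-splitˡ (wellFormed c) wf) b≤4)
  (input-kept d b (∧-splitʳ (wellFormed c) wf) b≤4)
input-kept (for x below r repeat c) b wf b≤4 = ∨-join
  (input≠ b x b≤4 (∧-splitˡ (4 <ᵇ x) wf))
  (input-kept c b (∧-splitʳ (not (writes c x)) (∧-splitʳ (4 <ᵇ x) wf)) b≤4)

eval-range : ∀ {n m} r s → s nᴬ 0 ≡ n → s mᴬ 0 ≡ m → eval s ⌜ r ⌝ ≡ size r n m
eval-range one s refl refl      = refl
eval-range jobs s refl refl     = refl
eval-range machines s refl refl = refl
eval-range (r ∔ r′) s n≡ m≡     = cong₂ _+_ (eval-range r s n≡ m≡) (eval-range r′ s n≡ m≡)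

n≤2^n : ∀ k → k ≤ 2 ^ k
n≤2^n zero    = z≤n
n≤2^n (suc k) = begin
  1 + k              ≤⟨ +-mono-≤ (m^n>0 2 k) (n≤2^n k) ⟩
  2 ^ k + 2 ^ k      ≡⟨ cong (2 ^ k +_) (+-identityʳ (2 ^ k)) ⟨
  2 ^ suc k          ∎
  where open ≤-Reasoning

Halts : Program → Memory → Memory → ℕ → Set
Halts A s s′ u = ∃ λ t → (A , s ⇓[ t ] s′) × t ≤ u

module Timing {N : ℕ} (2≤N : 2 ≤ N) where
  private instance
    N≢0 : NonZero N
    N≢0 = >-nonZero (<-≤-trans (s≤s z≤n) 2≤N)

  const-bound : ∀ k → k ≤ N ^ k
  const-bound k = ≤-trans (n≤2^n k) (^-monoˡ-≤ k 2≤N)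

  add-bound : ∀ {x y} a b → x ≤ N ^ a → y ≤ N ^ b → x + y ≤ N ^ suc (a + b)
  add-bound {x} {y} a b x≤ y≤ = begin
    x + y                     ≤⟨ +-mono-≤ (≤-trans x≤ (^-monoʳ-≤ N (m≤m+n a b)))
                                          (≤-trans y≤ (^-monoʳ-≤ N (m≤n+m b a))) ⟩
    N ^ (a + b) + N ^ (a + b) ≡⟨ cong (N ^ (a + b) +_) (+-identityʳ _) ⟨
    2 * N ^ (a + b)           ≤⟨ *-monoˡ-≤ (N ^ (a + b)) 2≤N ⟩
    N ^ suc (a + b)           ∎
    where open ≤-Reasoning

  mul-bound : ∀ {x y} a b → x ≤ N ^ a → y ≤ N ^ b → x * y ≤ N ^ (a + b)
  mul-bound {x} {y} a b x≤ y≤ =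
    ≤-trans (*-mono-≤ x≤ y≤) (≤-reflexive (sym (^-distribˡ-+-* N a b)))

  range-bound : ∀ {n m} → n ≤ N → m ≤ N → ∀ r → size r n m ≤ N ^ rangeDegree r
  range-bound n≤ m≤ one      = const-bound 1
  range-bound n≤ m≤ jobs     = ≤-trans n≤ (≤-reflexive (sym (*-identityʳ N)))
  range-bound n≤ m≤ machines = ≤-trans m≤ (≤-reflexive (sym (*-identityʳ N)))
  range-bound n≤ m≤ (r ∔ r′) =
    add-bound (rangeDegree r) (rangeDegree r′) (range-bound n≤ m≤ r) (range-bound n≤ m≤ r′)

  module _ {n m : ℕ} (n≤N : n ≤ N) (m≤N : m ≤ N) where

    while-halts : ∀ (f : Memory → Memory) x C u →
      Keeps x f → Keeps nᴬ f → Keeps mᴬ f →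
      does (nᴬ ≟ x) ≡ false → does (mᴬ ≟ x) ≡ false →
      (∀ s → s nᴬ 0 ≡ n → s mᴬ 0 ≡ m → Halts C s (f s) u) →
      ∀ k s → s x 0 ≡ k → s nᴬ 0 ≡ n → s mᴬ 0 ≡ m →
      Halts (whileNZ x [ lit 0 ] loop (x [ lit 0 ]≔ x [ lit 0 ] ⊖ lit 1 ⨾ C))
        s (countdown f x k s) (3 + k * (9 + u))
    while-halts f x C u kx kn km n≠x m≠x body zero s x≡ n≡ m≡ =
      3 , while-false x≡ , ≤-refl
    while-halts f x C u kx kn km n≠x m≠x body (suc k) s x≡ n≡ m≡
      with body (write s x 0 k) (trans (write-other s x 0 k nᴬ 0 n≠x) n≡)
                                (trans (write-other s x 0 k mᴬ 0 m≠x) m≡)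
    ... | t₁ , C⇓ , t₁≤
      with while-halts f x C u kx kn km n≠x m≠x body k (f (write s x 0 k))
             (trans (kx _ 0) (write-same s x 0 k))
             (trans (kn _ 0) (trans (write-other s x 0 k nᴬ 0 n≠x) n≡))
             (trans (km _ 0) (trans (write-other s x 0 k mᴬ 0 m≠x) m≡))
    ... | t₂ , W⇓ , t₂≤ =
      _ , while-true (λ eq → 1+n≢0 (trans (sym x≡) eq))
            (seq (subst (λ v → x [ lit 0 ]≔ x [ lit 0 ] ⊖ lit 1 , s ⇓[ 6 ] write s x 0 v)
                    (cong (_∸ 1) x≡) assign) C⇓) W⇓ ,
      bound
      where
      open ≤-Reasoning
      bound : 9 + t₁ + t₂ ≤ 3 + (9 + u + k * (9 + u))
      bound = begin
        9 + t₁ + t₂                  ≤⟨ +-mono-≤ (+-monoʳ-≤ 9 t₁≤) t₂≤ ⟩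
        9 + u + (3 + k * (9 + u))    ≡⟨ solve 2 (λ u r → con 9 :+ u :+ (con 3 :+ r) :=
                                          con 3 :+ (con 9 :+ u :+ r)) refl u (k * (9 + u)) ⟩
        3 + (9 + u + k * (9 + u))    ∎

    halts : ∀ c → wellFormed c ≡ true → ∀ s → s nᴬ 0 ≡ n → s mᴬ 0 ≡ m →
      Halts (compile c) s (run c s) (N ^ degree c)
    halts nop wf s n≡ m≡ = 1 , skip , ≤-refl
    halts (a [ e ]:= f) wf s n≡ m≡ = _ , assign , const-bound (suc (cost e + cost f))
    halts (c ⨟ d) wf s n≡ m≡ with
        halts c (∧-splitˡ (wellFormed c) wf) s n≡ m≡
      | halts d (∧-splitʳ (wellFormed c) wf) (run c s)
          (trans (run-keeps c nᴬ (input-kept c nᴬ (∧-splitˡ (wellFormed c) wf) refl) s 0) n≡)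
          (trans (run-keeps c mᴬ (input-kept c mᴬ (∧-splitˡ (wellFormed c) wf) refl) s 0) m≡)
    ... | t , c⇓ , t≤ | u , d⇓ , u≤ = t + u , seq c⇓ d⇓ , add-bound (degree c) (degree d) t≤ u≤
    halts (when e then c otherwise d) wf s n≡ m≡ with eval s e in eq
    ... | zero with halts d (∧-splitʳ (wellFormed c) wf) s n≡ m≡
    ...   | t , d⇓ , t≤ = _ , if-false eq d⇓ ,
      add-bound (suc (cost e)) (degree c + degree d) (const-bound (suc (cost e)))
        (≤-trans t≤ (^-monoʳ-≤ N (m≤n+m (degree d) (degree c))))
    halts (when e then c otherwise d) wf s n≡ m≡ | suc v
      with halts c (∧-splitˡ (wellFormed c) wf) s n≡ m≡
    ...   | t , c⇓ , t≤ = _ , if-true (λ e≡0 → 1+n≢0 (trans (sym eq) e≡0)) c⇓ ,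
      add-bound (suc (cost e)) (degree c + degree d) (const-bound (suc (cost e)))
        (≤-trans t≤ (^-monoʳ-≤ N (m≤m+n (degree c) (degree d))))
    halts (for x below r repeat c) wf s n≡ m≡ with
      while-halts (run c) x (compile c) (N ^ degree c)
        (run-keeps c x (not-true _ (∧-splitˡ (not (writes c x)) wf′)))
        (run-keeps c nᴬ (input-kept c nᴬ wfc refl))
        (run-keeps c mᴬ (input-kept c mᴬ wfc refl))
        (input≠ nᴬ x refl (∧-splitˡ (4 <ᵇ x) wf)) (input≠ mᴬ x refl (∧-splitˡ (4 <ᵇ x) wf))
        (λ s′ → halts c wfc s′)
        (eval s ⌜ r ⌝) (write s x 0 (eval s ⌜ r ⌝)) (write-same s x 0 _)
        (trans (write-other s x 0 _ nᴬ 0 (input≠ nᴬ x refl (∧-splitˡ (4 <ᵇ x) wf))) n≡)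
        (trans (write-other s x 0 _ mᴬ 0 (input≠ mᴬ x refl (∧-splitˡ (4 <ᵇ x) wf))) m≡)
      where
      wf′ = ∧-splitʳ (4 <ᵇ x) wf
      wfc = ∧-splitʳ (not (writes c x)) wf′
    ... | t , W⇓ , t≤ = _ , seq assign W⇓ ,
      add-bound (suc (1 + cost ⌜ r ⌝)) _ (const-bound (suc (1 + cost ⌜ r ⌝)))
        (≤-trans t≤ (add-bound 3 (rangeDegree r + suc (9 + degree c)) (const-bound 3)
          (mul-bound (rangeDegree r) (suc (9 + degree c))
            (≤-trans (≤-reflexive (eval-range r s n≡ m≡)) (range-bound n≤N m≤N r))
            (add-bound 9 (degree c) (const-bound 9) ≤-refl))))

Unchanged : Cmd → Memory → Memory → Set
Unchanged c s s′ = ∀ b l → writes c b ≡ false → s′ b l ≡ s b l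

when-rule : ∀ (P : Memory → Set) e c d s →
  (eval s e ≢ 0 → P (run c s)) → (eval s e ≡ 0 → P (run d s)) →
  P (run (when e then c otherwise d) s)
when-rule P e c d s Pc Pd with eval s e
... | zero  = Pd refl
... | suc _ = Pc λ ()

for-rule : ∀ (P : ℕ → Memory → Set) x r c s {N} → eval s ⌜ r ⌝ ≡ N →
  (∀ (k : Fin N) s′ → Unchanged (for x below r repeat c) s s′ →
     P (suc (toℕ k)) s′ → P (toℕ k) (run c (write s′ x 0 (toℕ k)))) →
  P N (write s x 0 N) → P 0 (run (for x below r repeat c) s)
for-rule P x r c s {N} refl step base =
  go N ≤-refl (write s x 0 N)
    (λ b l eq → write-other s x 0 N b l (∨-falseˡ (does (b ≟ x)) eq)) base
  where
  go : ∀ k → k ≤ N → ∀ s′ → Unchanged (for x below r repeat c) s s′ → P k s′ →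
    P 0 (countdown (run c) x k s′)
  go zero _ s′ same Pk = Pk
  go (suc k) k<N s′ same Pk = go k (<⇒≤ k<N) _
    (λ b l eq → trans (run-keeps c b (∨-falseʳ (does (b ≟ x)) eq) (write s′ x 0 k) l)
      (trans (write-other s′ x 0 k b l (∨-falseˡ (does (b ≟ x)) eq)) (same b l eq)))
    (subst (λ i → P i (run c (write s′ x 0 i))) (Fin.toℕ-fromℕ< k<N)
      (step (fromℕ< k<N) s′ same (subst (λ i → P (suc i) s′) (sym (Fin.toℕ-fromℕ< k<N)) Pk)))

-- Push–relabel for assignments

Σ-mono : ∀ {n} {f g : Fin n → ℕ} → (∀ i → f i ≤ g i) → Σℕ f ≤ Σℕ g
Σ-mono {zero}  f≤g = z≤n
Σ-mono {suc n} f≤g = +-mono-≤ (f≤g zero) (Σ-mono (f≤g ∘ suc))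

Σ-mono-< : ∀ {n} {f g : Fin n → ℕ} → (∀ i → f i ≤ g i) → ∀ j → f j < g j → Σℕ f < Σℕ g
Σ-mono-< f≤g zero    f<g = +-mono-<-≤ f<g (Σ-mono (f≤g ∘ suc))
Σ-mono-< f≤g (suc j) f<g = +-mono-≤-< (f≤g zero) (Σ-mono-< (f≤g ∘ suc) j f<g)

Σ-mono-except : ∀ {n} {f g : Fin n → ℕ} j {c} → (∀ i → i ≢ j → f i ≤ g i) →
  f j ≤ c + g j → Σℕ f ≤ c + Σℕ g
Σ-mono-except {suc n} {f} {g} zero {c} f≤g fj = ≤-trans
  (+-mono-≤ fj (Σ-mono λ i → f≤g (suc i) λ ()))
  (≤-reflexive (+-assoc c (g zero) _))
Σ-mono-except {suc n} {f} {g} (suc j) {c} f≤g fj = ≤-trans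
  (+-mono-≤ (f≤g zero λ ()) (Σ-mono-except j (λ i i≢j → f≤g (suc i) (i≢j ∘ Fin.suc-injective)) fj))
  (≤-reflexive (trans (sym (+-assoc (g zero) c _))
    (trans (cong (_+ Σℕ (g ∘ suc)) (+-comm (g zero) c)) (+-assoc c (g zero) _))))

Σ-const : ∀ n c → Σℕ {n} (λ _ → c) ≡ n * c
Σ-const zero    c = refl
Σ-const (suc n) c = cong (c +_) (Σ-const n c)

≤Σ : ∀ {n} (f : Fin n → ℕ) i → f i ≤ Σℕ f
≤Σ f zero    = m≤m+n _ _
≤Σ f (suc i) = ≤-trans (≤Σ (f ∘ suc) i) (m≤n+m _ _)

Σ-* : ∀ {n} c (f : Fin n → ℕ) → Σℕ (λ i → c * f i) ≡ c * Σℕ f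
Σ-* {zero}  c f = sym (*-zeroʳ c)
Σ-* {suc n} c f = trans (cong (c * f zero +_) (Σ-* c (f ∘ suc))) (sym (*-distribˡ-+ c (f zero) _))

Σ-cong : ∀ {n} {f g : Fin n → ℕ} → f ≗ g → Σℕ f ≡ Σℕ g
Σ-cong = sum-cong-≗ +-0-commutativeMonoid

Σ-single : ∀ {n} (a : Fin n) (f : Fin n → ℕ) →
  Σℕ (λ i → if does (a Fin.≟ i) then f i else 0) ≡ f a
Σ-single {suc n} zero f =
  trans (cong (f zero +_) (trans (Σ-const n 0) (*-zeroʳ n))) (+-identityʳ _)
Σ-single (suc a) f = Σ-single a (f ∘ suc)

≤Max : ∀ {n} (f : Fin n → ℕ) i → f i ≤ Max f
≤Max f zero    = m≤m⊔n _ _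
≤Max f (suc i) = ≤-trans (≤Max (f ∘ suc) i) (m≤n⊔m _ _)

Max≤ : ∀ {n} (f : Fin n → ℕ) {b} → (∀ i → f i ≤ b) → Max f ≤ b
Max≤ {zero}  f f≤ = z≤n
Max≤ {suc n} f f≤ = ⊔-lub (f≤ zero) (Max≤ (f ∘ suc) (f≤ ∘ suc))

gap : ∀ {m} (d : Fin m → ℕ) u → m ≤ d u → ∃ λ g → g < d u × (∀ v → d v ≢ g)
gap {m} d u m≤du with Fin.any? (λ (g : Fin m) → Fin.all? λ v → ¬? (d v ≟ toℕ g))
... | yes (g , free) = toℕ g , <-≤-trans (Fin.toℕ<n g) m≤du , free
... | no ¬free = contradiction (Fin.pigeonhole ≤-refl at) no-collision
  where
  holder : ∀ g → ∃ λ v → d v ≡ toℕ g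
  holder g with Fin.any? (λ v → d v ≟ toℕ g)
  ... | yes held = held
  ... | no ¬held = contradiction (g , λ v eq → ¬held (v , eq)) ¬free
  at : Fin (suc m) → Fin m
  at zero    = u
  at (suc g) = proj₁ (holder g)
  no-collision : ¬ (∃ λ i → ∃ λ j → toℕ i < toℕ j × at i ≡ at j)
  no-collision (zero , suc g , _ , eq) = <⇒≱ (Fin.toℕ<n g)
    (subst (m ≤_) (trans (cong d eq) (proj₂ (holder g))) m≤du)
  no-collision (suc f , suc g , s≤s f<g , eq) = <⇒≢ f<g
    (trans (sym (proj₂ (holder f))) (trans (cong d eq) (proj₂ (holder g))))

module _ {n m : ℕ} (I : Instance n m) where
  open Instance I

  load-except : ∀ {σ σ′} j → (∀ k → k ≢ j → σ′ k ≡ σ k) → ∀ u {c} →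
    (σ j ≡ u → σ′ j ≢ u → p j ≤ c) → load I σ u ≤ c + load I σ′ u
  load-except {σ} {σ′} j same u {c} lost = Σ-mono-except j
    (λ k k≢j → ≤-reflexive (cong (λ x → if does (x Fin.≟ u) then p k else 0) (sym (same k k≢j))))
    at-j
    where
    at-j : (if does (σ j Fin.≟ u) then p j else 0) ≤ c + (if does (σ′ j Fin.≟ u) then p j else 0)
    at-j with σ j Fin.≟ u | σ′ j Fin.≟ u
    ... | no _  | _     = z≤n
    ... | yes _ | yes _ = m≤n+m _ c
    ... | yes a | no b  = ≤-trans (lost a b) (m≤m+n c 0)

  load-cong : ∀ {σ σ′} → σ ≗ σ′ → load I σ ≗ load I σ′
  load-cong eq u = Σ-cong λ j → cong (λ x → if does (x Fin.≟ u) then p j else 0) (eq j)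

  weighted-load : ∀ (w : Fin m → ℕ) σ → Σℕ (λ i → w i * load I σ i) ≡ Σℕ (λ j → w (σ j) * p j)
  weighted-load w σ = begin
    Σℕ (λ i → w i * load I σ i)
      ≡⟨ Σ-cong (λ i → Σ-* (w i) (λ j → if does (σ j Fin.≟ i) then p j else 0)) ⟨
    Σℕ (λ i → Σℕ (λ j → w i * (if does (σ j Fin.≟ i) then p j else 0)))
      ≡⟨ Σ-cong (λ i → Σ-cong (λ j → pull i j)) ⟩
    Σℕ (λ i → Σℕ (λ j → if does (σ j Fin.≟ i) then w i * p j else 0))
      ≡⟨ ∑-comm +-0-commutativeMonoid (λ i j → if does (σ j Fin.≟ i) then w i * p j else 0) ⟩
    Σℕ (λ j → Σℕ (λ i → if does (σ j Fin.≟ i) then w i * p j else 0))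
      ≡⟨ Σ-cong (λ j → Σ-single (σ j) (λ i → w i * p j)) ⟩
    Σℕ (λ j → w (σ j) * p j) ∎
    where
    open ≡-Reasoning
    pull : ∀ i j → w i * (if does (σ j Fin.≟ i) then p j else 0) ≡
                   (if does (σ j Fin.≟ i) then w i * p j else 0)
    pull i j with does (σ j Fin.≟ i)
    ... | true  = refl
    ... | false = *-zeroʳ (w i)

  Overloaded : ℕ → ℕ → Assignment n m → Fin m → Set
  Overloaded T θ σ u = T + θ < load I σ u

  Admissible : ℕ → ℕ → Assignment n m → (Fin m → ℕ) → Fin n → Fin m → Set
  Admissible T θ σ d j v = p j ≤ θ × v ∈ˢ Γ j × Overloaded T θ σ (σ j) × d v < d (σ j)

  data Step (T θ : ℕ) (σ : Assignment n m) (d : Fin m → ℕ)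
            (σ′ : Assignment n m) (d′ : Fin m → ℕ) : Set where
    push    : ∀ j v → Admissible T θ σ d j v →
      σ′ j ≡ v → (∀ k → k ≢ j → σ′ k ≡ σ k) → d′ ≗ d → Step T θ σ d σ′ d′
    relabel : ∀ u → Overloaded T θ σ u → (∀ j v → ¬ Admissible T θ σ d j v) →
      σ′ ≗ σ → d′ u ≡ suc (d u) → (∀ v → v ≢ u → d′ v ≡ d v) → Step T θ σ d σ′ d′
    stay    : (∀ u → ¬ Overloaded T θ σ u) → σ′ ≗ σ → d′ ≗ d → Step T θ σ d σ′ d′

  Settled : ℕ → ℕ → Assignment n m → Set
  Settled T θ σ = ∀ u → load I σ u ≤ T + θ

  step-settled : ∀ {T θ σ d σ′ d′} → Step T θ σ d σ′ d′ → Settled T θ σ → Settled T θ σ′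
  step-settled {σ = σ} (push j v (_ , _ , over , _) _ _ _) ok = contradiction over (≤⇒≯ (ok (σ j)))
  step-settled (relabel u over _ _ _ _) ok = contradiction over (≤⇒≯ (ok u))
  step-settled (stay _ eq _) ok u = subst (_≤ _) (load-cong (sym ∘ eq) u) (ok u)

  step-feasible : ∀ {T θ σ d σ′ d′} → Step T θ σ d σ′ d′ → Feasible I σ → Feasible I σ′
  step-feasible (push j v (_ , v∈Γ , _) σ′j same _) f k with k Fin.≟ j
  ... | yes refl = subst (_∈ˢ Γ j) (sym σ′j) v∈Γ
  ... | no k≢j   = subst (_∈ˢ Γ k) (sym (same k k≢j)) (f k)
  step-feasible (relabel _ _ _ eq _ _) f = Feasible-resp I (sym ∘ eq) f
  step-feasible (stay _ eq _) f = Feasible-resp I (sym ∘ eq) f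

  module Relabelling {T θ : ℕ} (σ* : Assignment n m) (σ*-feasible : Feasible I σ*)
                     (σ*-load : ∀ i → load I σ* i ≤ T) where

    record Invariant (σ : Assignment n m) (d : Fin m → ℕ) : Set where
      field
        large  : ∀ j → θ < p j → σ j ≡ σ* j
        valid  : ∀ j v → p j ≤ θ → v ∈ˢ Γ j → d (σ j) ≤ suc (d v)
        ground : ∀ u → load I σ u ≤ T → d u ≡ 0

    open Invariant

    -- Above an empty level the labels cut off a set of machines that all have
    -- load above T and whose jobs σ* cannot process elsewhere.
    label<m : ∀ {σ d} → Invariant σ d → ∀ u → d u < m
    label<m {σ} {d} inv u = ≰⇒> λ m≤du →
      let g , g<du , free = gap d u m≤du in above-gap g g<du free
      where
      above-gap : ∀ g → g < d u → (∀ v → d v ≢ g) → ⊥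
      above-gap g g<du free = <-irrefl refl (begin-strict
        Σℕ (λ i → w i * T)            <⟨ Σ-mono-< heavy u heavy-u ⟩
        Σℕ (λ i → w i * load I σ i)   ≡⟨ weighted-load w σ ⟩
        Σℕ (λ j → w (σ j) * p j)      ≤⟨ Σ-mono (λ j → *-monoˡ-≤ (p j) (confined j)) ⟩
        Σℕ (λ j → w (σ* j) * p j)     ≡⟨ weighted-load w σ* ⟨
        Σℕ (λ i → w i * load I σ* i)  ≤⟨ Σ-mono (λ i → *-monoʳ-≤ (w i) (σ*-load i)) ⟩
        Σℕ (λ i → w i * T)            ∎)
        where
        open ≤-Reasoning
        w : Fin m → ℕ
        w i = if does (g <? d i) then 1 else 0
        w-in : ∀ {i} → g < d i → w i ≡ 1
        w-in {i} g<di rewrite dec-true (g <? d i) g<di = refl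
        w-out : ∀ {i} → ¬ g < d i → w i ≡ 0
        w-out {i} g≮di rewrite dec-false (g <? d i) g≮di = refl
        heavy-in : ∀ i → g < d i → T < load I σ i
        heavy-in i g<di = ≰⇒> λ light → n≮0 (subst (g <_) (ground inv i light) g<di)
        heavy : ∀ i → w i * T ≤ w i * load I σ i
        heavy i with g <? d i
        ... | no g≮di  = ≤-trans (≤-reflexive (cong (_* T) (w-out g≮di))) z≤n
        ... | yes g<di = *-monoʳ-≤ (w i) (<⇒≤ (heavy-in i g<di))
        heavy-u : w u * T < w u * load I σ u
        heavy-u rewrite w-in g<du = *-monoʳ-< 1 (heavy-in u g<du)
        confined : ∀ j → w (σ j) ≤ w (σ* j)
        confined j with g <? d (σ j) | p j ≤? θ
        ... | no g≮  | _       = ≤-trans (≤-reflexive (w-out g≮)) z≤n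
        ... | yes g< | no p≰θ  = ≤-reflexive (trans (w-in g<) (sym (w-in
          (subst (λ x → g < d x) (large inv j (≰⇒> p≰θ)) g<))))
        ... | yes g< | yes p≤θ = ≤-reflexive (trans (w-in g<) (sym (w-in
          (≤∧≢⇒< (s≤s⁻¹ (≤-trans g< (valid inv j (σ* j) p≤θ (σ*-feasible j)))) (≢-sym (free (σ* j)))))))

    -- A push lowers one d (σ j) and a relabelling raises Σ d, so either step
    -- raises the potential.
    potential : Assignment n m → (Fin m → ℕ) → ℕ
    potential σ d = Σℕ d + Σℕ λ j → Σℕ d ∸ d (σ j)

    potential-bound : ∀ {σ d} → Invariant σ d → potential σ d ≤ m * m + n * (m * m)
    potential-bound {σ} {d} inv = +-mono-≤ S≤ (≤-trans
      (Σ-mono λ j → ≤-trans (m∸n≤m (Σℕ d) (d (σ j))) S≤) (≤-reflexive (Σ-const n (m * m))))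
      where
      S≤ : Σℕ d ≤ m * m
      S≤ = ≤-trans (Σ-mono λ u → <⇒≤ (label<m inv u)) (≤-reflexive (Σ-const m m))

    step-progress : ∀ {σ d σ′ d′} → Step T θ σ d σ′ d′ → Invariant σ d →
      Settled T θ σ′ ⊎ (Invariant σ′ d′ × potential σ d < potential σ′ d′)
    step-progress {σ} {d} {σ′} {d′} (push j v (p≤θ , v∈Γ , over , v<) σ′j same d≗) inv = inj₂
      ( record { large = large′ ; valid = valid′ ; ground = ground′ }
      , subst₂ _<_ refl (cong₂ _+_ (sym S≡) (Σ-cong λ k → cong₂ _∸_ (sym S≡) (sym (d≗ (σ′ k)))))
          (+-monoʳ-< (Σℕ d) (Σ-mono-< slack≤ j strict)) )
      where
      S≡ : Σℕ d′ ≡ Σℕ d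
      S≡ = Σ-cong d≗
      large′ : ∀ k → θ < p k → σ′ k ≡ σ* k
      large′ k θ<p with k Fin.≟ j
      ... | yes refl = contradiction p≤θ (<⇒≱ θ<p)
      ... | no k≢j   = trans (same k k≢j) (large inv k θ<p)
      valid′ : ∀ k w → p k ≤ θ → w ∈ˢ Γ k → d′ (σ′ k) ≤ suc (d′ w)
      valid′ k w p≤ w∈ rewrite d≗ (σ′ k) | d≗ w with k Fin.≟ j
      ... | no k≢j rewrite same k k≢j = valid inv k w p≤ w∈
      ... | yes refl rewrite σ′j = ≤-trans (<⇒≤ v<) (valid inv k w p≤ w∈)
      ground′ : ∀ u → load I σ′ u ≤ T → d′ u ≡ 0
      ground′ u light = trans (d≗ u) (case u Fin.≟ σ j of λ where
        (yes refl) → contradiction over (≤⇒≯ (≤-trans (load-except j same (σ j) (λ _ _ → ≤-refl))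
          (≤-trans (+-mono-≤ p≤θ light) (≤-reflexive (+-comm θ T)))))
        (no u≢σj) → ground inv u (≤-trans
          (load-except j same u {0} (λ eq _ → contradiction (sym eq) u≢σj)) light))
      slack≤ : ∀ k → Σℕ d ∸ d (σ k) ≤ Σℕ d ∸ d (σ′ k)
      slack≤ k with k Fin.≟ j
      ... | no k≢j   rewrite same k k≢j = ≤-refl
      ... | yes refl rewrite σ′j = ∸-monoʳ-≤ (Σℕ d) (<⇒≤ v<)
      strict : Σℕ d ∸ d (σ j) < Σℕ d ∸ d (σ′ j)
      strict rewrite σ′j = ∸-monoʳ-< v< (≤Σ d (σ j))
    step-progress {σ} {d} {σ′} {d′} (relabel u over stuck σ≗ d′u same) inv = inj₂
      ( record { large = λ j θ<p → trans (σ≗ j) (large inv j θ<p) ; valid = valid′ ; ground = ground′ }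
      , +-mono-<-≤ S< (Σ-mono slack≤) )
      where
      d≤d′ : ∀ v → d v ≤ d′ v
      d≤d′ v with v Fin.≟ u
      ... | yes refl = ≤-trans (n≤1+n _) (≤-reflexive (sym d′u))
      ... | no v≢u   = ≤-reflexive (sym (same v v≢u))
      d′≤1+d : ∀ v → d′ v ≤ suc (d v)
      d′≤1+d v with v Fin.≟ u
      ... | yes refl = ≤-reflexive d′u
      ... | no v≢u   = ≤-trans (≤-reflexive (same v v≢u)) (n≤1+n _)
      S< : Σℕ d < Σℕ d′
      S< = Σ-mono-< d≤d′ u (≤-reflexive (sym d′u))
      slack≤ : ∀ j → Σℕ d ∸ d (σ j) ≤ Σℕ d′ ∸ d′ (σ′ j)
      slack≤ j rewrite σ≗ j = ≤-trans (∸-mono S< (≤-refl {suc (d (σ j))}))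
        (∸-monoʳ-≤ (Σℕ d′) (d′≤1+d (σ j)))
      valid′ : ∀ j v → p j ≤ θ → v ∈ˢ Γ j → d′ (σ′ j) ≤ suc (d′ v)
      valid′ j v p≤ v∈ rewrite σ≗ j with σ j Fin.≟ u
      ... | no σj≢u = ≤-trans (≤-reflexive (same (σ j) σj≢u))
        (≤-trans (valid inv j v p≤ v∈) (s≤s (d≤d′ v)))
      ... | yes refl = ≤-trans (≤-reflexive d′u) (s≤s (≤-trans
        (≮⇒≥ λ v< → stuck j v (p≤ , v∈ , over , v<)) (d≤d′ v)))
      ground′ : ∀ v → load I σ′ v ≤ T → d′ v ≡ 0
      ground′ v light rewrite load-cong σ≗ v with v Fin.≟ u
      ... | yes refl = contradiction over (≤⇒≯ (≤-trans light (m≤m+n T θ)))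
      ... | no v≢u   = trans (same v v≢u) (ground inv v light)
    step-progress (stay none σ≗ _) inv = inj₁ λ u →
      subst (_≤ T + θ) (load-cong (sym ∘ σ≗) u) (≮⇒≥ (none u))

    Progress : ℕ → Assignment n m → (Fin m → ℕ) → Set
    Progress r σ d = Settled T θ σ ⊎ (Invariant σ d × r ≤ potential σ d)

    progress-step : ∀ {r σ d σ′ d′} → Step T θ σ d σ′ d′ → Progress r σ d → Progress (suc r) σ′ d′
    progress-step st (inj₁ ok) = inj₁ (step-settled st ok)
    progress-step st (inj₂ (inv , r≤)) with step-progress st inv
    ... | inj₁ ok          = inj₁ ok
    ... | inj₂ (inv′ , <Ψ) = inj₂ (inv′ , ≤-trans (s≤s r≤) <Ψ)

    progress-end : ∀ {r σ d} → m * m + n * (m * m) < r → Progress r σ d → Settled T θ σ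
    progress-end r> (inj₁ ok) = ok
    progress-end r> (inj₂ (inv , r≤)) = contradiction (≤-trans r≤ (potential-bound inv)) (<⇒≱ r>)

    progress-start : ∀ {σ d} → (∀ j → θ < p j → σ j ≡ σ* j) → (∀ u → d u ≡ 0) → Progress 0 σ d
    progress-start {σ} large₀ zeros = inj₂
      ( record { large = large₀
               ; valid = λ j v _ _ → ≤-trans (≤-reflexive (zeros (σ j))) z≤n
               ; ground = λ u _ → zeros u }
      , z≤n )

  start-load : ∀ {θ σ σ*} → (∀ j → θ < p j → σ j ≡ σ* j) → ∀ u →
    load I σ u ≤ load I σ* u + n * θ
  start-load {θ} {σ} {σ*} large u = begin
    load I σ u            ≤⟨ Σ-mono at ⟩
    Σℕ (λ j → t j + θ)    ≡⟨ ∑-distrib-+ +-0-commutativeMonoid t (λ _ → θ) ⟩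
    load I σ* u + Σℕ {n} (λ _ → θ)  ≡⟨ cong (load I σ* u +_) (Σ-const n θ) ⟩
    load I σ* u + n * θ   ∎
    where
    open ≤-Reasoning
    t : Fin n → ℕ
    t j = if does (σ* j Fin.≟ u) then p j else 0
    at : ∀ j → (if does (σ j Fin.≟ u) then p j else 0) ≤ t j + θ
    at j with p j ≤? θ
    ... | no p≰θ rewrite large j (≰⇒> p≰θ) = m≤m+n _ θ
    ... | yes p≤θ with does (σ j Fin.≟ u)
    ...   | true  = ≤-trans p≤θ (m≤n+m θ _)
    ...   | false = z≤n

threshold-index : ∀ {O L θ} k → O ≤ L → L ≤ O + k * θ →
  ∃ λ i → i ≤ k × O ≤ L ∸ i * θ × L ∸ i * θ ≤ O + θ
threshold-index {O} {L} {θ} zero O≤L L≤ =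
  0 , z≤n , O≤L , ≤-trans L≤ (+-monoʳ-≤ O z≤n)
threshold-index {O} {L} {θ} (suc k) O≤L L≤ with L ≤? O + k * θ
... | yes L≤′ = let i , i≤k , lo , hi = threshold-index k O≤L L≤′ in i , m≤n⇒m≤1+n i≤k , lo , hi
... | no L≰ = k , n≤1+n k , m+n≤o⇒m≤o∸n O (≰⇒≥ L≰) ,
  ≤-trans (∸-monoˡ-≤ (k * θ) L≤) (≤-reflexive
    (trans (cong (_∸ k * θ) (sym (+-assoc O θ (k * θ)))) (m+n∸n≡m (O + θ) (k * θ))))

-- Starting schedules and loads

partial : ∀ {n} → (Fin n → ℕ) → ℕ → ℕ
partial         f zero    = 0
partial {zero}  f (suc k) = 0
partial {suc n} f (suc k) = f zero + partial (f ∘ suc) k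

partial-all : ∀ {n} (f : Fin n → ℕ) → partial f n ≡ Σℕ f
partial-all {zero}  f = refl
partial-all {suc n} f = cong (f zero +_) (partial-all (f ∘ suc))

partial-suc : ∀ {n} (f : Fin n → ℕ) k → partial f (suc (toℕ k)) ≡ f k + partial f (toℕ k)
partial-suc {suc n} f zero    = refl
partial-suc {suc n} f (suc k) = trans (cong (f zero +_) (partial-suc (f ∘ suc) k))
  (trans (sym (+-assoc (f zero) (f (suc k)) _))
  (trans (cong (_+ partial (f ∘ suc) (toℕ k)) (+-comm (f zero) (f (suc k))))
         (+-assoc (f (suc k)) (f zero) _)))

partial-zero : ∀ {n} (f : Fin n → ℕ) → partial f 0 ≡ 0
partial-zero {zero}  f = refl
partial-zero {suc n} f = refl

array-at : ∀ {k} (f : Fin k → ℕ) i → array f (toℕ i) ≡ f i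
array-at {k} f i with toℕ i <? k
... | yes i<k = cong f (Fin.fromℕ<-toℕ i i<k)
... | no  i≮k = contradiction (Fin.toℕ<n i) i≮k

-- Loops count down: before iteration k the indices above k are done.
extend : ∀ {n} (Q : Fin n → Set) (k : Fin n) → Q k →
  (∀ i → suc (toℕ k) ≤ toℕ i → Q i) → ∀ i → toℕ k ≤ toℕ i → Q i
extend Q k Qk rest i k≤i with m≤n⇒m<n∨m≡n k≤i
... | inj₁ k<i = rest i k<i
... | inj₂ k≡i = subst Q (Fin.toℕ-injective k≡i) Qk

beyond : ∀ {n} (Q : Fin n → Set) i → n ≤ toℕ i → Q i
beyond Q i n≤i = contradiction (Fin.toℕ<n i) (≤⇒≯ n≤i)

run-unchanged : ∀ c s → Unchanged c s (run c s)
run-unchanged c s b l eq = run-keeps c b eq s l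

rowᴬ bestᴬ τᴬ σᴬ loadᴬ maxᴬ Tᴬ dᴬ foundᴬ jᴬ vᴬ uᴬ θᴬ : Name
rowᴬ   = 6
bestᴬ  = 7
τᴬ     = 8
σᴬ     = 9
loadᴬ  = 10
maxᴬ   = 11
Tᴬ     = 12
dᴬ     = 13
foundᴬ = 14
jᴬ     = 15
vᴬ     = 16
uᴬ     = 17
θᴬ     = 18

Jᴬ Iᴬ Qᴬ Kᴬ Aᴬ Bᴬ Cᴬ : Name
Jᴬ = 20
Iᴬ = 21
Qᴬ = 22
Kᴬ = 23
Aᴬ = 24
Bᴬ = 25
Cᴬ = 26

val : Name → Exp
val x = x [ lit 0 ]

row-add row-step row-fill row-body rows : Cmd
row-add  = rowᴬ [ val Jᴬ ]:= rowᴬ [ val Jᴬ ] ⊕ val mᴬ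
row-step = when val Jᴬ ⊖ val Iᴬ then row-add otherwise nop
row-fill = for Iᴬ below jobs repeat row-step
row-body = rowᴬ [ val Jᴬ ]:= lit 0 ⨟ row-fill
rows     = for Jᴬ below jobs repeat row-body

eligible : Exp → Exp
eligible e = Γᴬ [ rowᴬ [ val Jᴬ ] ⊕ e ]

pick-set pick-step pick prefer-set prefer-eligible prefer start-body start : Cmd
pick-set        = σᴬ [ val Jᴬ ]:= val Iᴬ
pick-step       = when eligible (val Iᴬ) then pick-set otherwise nop
pick            = for Iᴬ below machines repeat pick-step
prefer-set      = σᴬ [ val Jᴬ ]:= τᴬ [ val Jᴬ ]
prefer-eligible = when eligible (τᴬ [ val Jᴬ ]) then prefer-set otherwise nop
prefer          = when pᴬ [ val Jᴬ ] ⊖ val θᴬ then prefer-eligible otherwise nop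
start-body      = pick ⨟ prefer
start           = for Jᴬ below jobs repeat start-body

zero-entry clear : Name → Cmd
zero-entry a = a [ val Iᴬ ]:= lit 0
clear a      = for Iᴬ below machines repeat zero-entry a

load-increase load-add loads : Cmd
load-increase = loadᴬ [ σᴬ [ val Jᴬ ] ]:= loadᴬ [ σᴬ [ val Jᴬ ] ] ⊕ pᴬ [ val Jᴬ ]
load-add      = for Jᴬ below jobs repeat load-increase
loads         = clear loadᴬ ⨟ load-add

max-set max-step max-loop maximum evaluate : Cmd
max-set  = maxᴬ [ lit 0 ]:= loadᴬ [ val Iᴬ ]
max-step = when loadᴬ [ val Iᴬ ] ⊖ val maxᴬ then max-set otherwise nop
max-loop = for Iᴬ below machines repeat max-step
maximum  = maxᴬ [ lit 0 ]:= lit 0 ⨟ max-loop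
evaluate = loads ⨟ maximum

touchesContext : Cmd → Bool
touchesContext c = writes c nᴬ ∨ (writes c mᴬ ∨ (writes c pᴬ ∨ (writes c Γᴬ ∨ writes c rowᴬ)))

Holds : ∀ {n m} → Memory → Name → Assignment n m → Set
Holds s a σ = ∀ j → s a (toℕ j) ≡ toℕ (σ j)

row-fill-spec : ∀ {n} (j : Fin n) s → s nᴬ 0 ≡ n → s Jᴬ 0 ≡ toℕ j → s rowᴬ (toℕ j) ≡ 0 →
  run row-fill s rowᴬ (toℕ j) ≡ toℕ j * s mᴬ 0 ×
  (∀ l → l ≢ toℕ j → run row-fill s rowᴬ l ≡ s rowᴬ l)
row-fill-spec {n} j s n≡ j≡ row≡0 = for-rule P Iᴬ jobs row-step s n≡ step
  (trans row≡0 (cong (_* s mᴬ 0) (sym (m≤n⇒m∸n≡0 (<⇒≤ (Fin.toℕ<n j))))) , λ l _ → refl)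
  where
  P : ℕ → Memory → Set
  P k s′ = s′ rowᴬ (toℕ j) ≡ (toℕ j ∸ k) * s mᴬ 0 × (∀ l → l ≢ toℕ j → s′ rowᴬ l ≡ s rowᴬ l)
  step : ∀ (k : Fin n) s′ → Unchanged row-fill s s′ → P (suc (toℕ k)) s′ →
    P (toℕ k) (run row-step (write s′ Iᴬ 0 (toℕ k)))
  step k s′ same (at , others) = when-rule (P (toℕ k)) (val Jᴬ ⊖ val Iᴬ) row-add nop
    (write s′ Iᴬ 0 (toℕ k))
    (λ J∸k≢0 → let k<j = m∸n≢0⇒n<m {toℕ j} {toℕ k} (subst (λ x → x ∸ toℕ k ≢ 0) sJ J∸k≢0) in
      (write-case (_≡ (toℕ j ∸ toℕ k) * s mᴬ 0) (write s′ Iᴬ 0 (toℕ k)) rowᴬ (s′ Jᴬ 0) _ (toℕ j)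
        (λ _ → trans (cong₂ _+_ (trans (cong (s′ rowᴬ) sJ) at) (same mᴬ 0 refl))
          (trans (+-comm _ (s mᴬ 0)) (sym (cong (_* s mᴬ 0) (+-∸-assoc 1 k<j)))))
        (λ j≢ → contradiction (sym sJ) j≢)) ,
      λ l l≢j → write-case (_≡ s rowᴬ l) (write s′ Iᴬ 0 (toℕ k)) rowᴬ (s′ Jᴬ 0) _ l
        (λ l≡ → contradiction (trans l≡ sJ) l≢j) (λ _ → others l l≢j))
    (λ J∸k≡0 → let j≤k = m∸n≡0⇒m≤n {toℕ j} {toℕ k} (subst (λ x → x ∸ toℕ k ≡ 0) sJ J∸k≡0) in
      trans at (cong (_* s mᴬ 0)
        (trans (m≤n⇒m∸n≡0 (m≤n⇒m≤1+n j≤k)) (sym (m≤n⇒m∸n≡0 j≤k)))) , others)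
    where
    sJ : s′ Jᴬ 0 ≡ toℕ j
    sJ = trans (same Jᴬ 0 refl) j≡

rows-spec : ∀ {n} s → s nᴬ 0 ≡ n → ∀ (j : Fin n) → run rows s rowᴬ (toℕ j) ≡ toℕ j * s mᴬ 0
rows-spec {n} s n≡ j = for-rule P Jᴬ jobs row-body s n≡ step (beyond _) j z≤n
  where
  P : ℕ → Memory → Set
  P k s′ = ∀ (j : Fin n) → k ≤ toℕ j → s′ rowᴬ (toℕ j) ≡ toℕ j * s mᴬ 0
  step : ∀ (k : Fin n) s′ → Unchanged rows s s′ → P (suc (toℕ k)) s′ →
    P (toℕ k) (run row-body (write s′ Jᴬ 0 (toℕ k)))
  step k s′ same done = extend (λ j → run row-fill s″ rowᴬ (toℕ j) ≡ toℕ j * s mᴬ 0) k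
    (trans (proj₁ inner) (cong (toℕ k *_) (same mᴬ 0 refl)))
    λ i k<i → trans (proj₂ inner (toℕ i) (<⇒≢ k<i ∘ sym))
      (write-case (_≡ toℕ i * s mᴬ 0) (write s′ Jᴬ 0 (toℕ k)) rowᴬ (toℕ k) 0 (toℕ i)
        (λ i≡k → contradiction (sym i≡k) (<⇒≢ k<i)) (λ _ → done i k<i))
    where
    s″ : Memory
    s″ = write (write s′ Jᴬ 0 (toℕ k)) rowᴬ (toℕ k) 0
    inner = row-fill-spec k s″ (trans (same nᴬ 0 refl) n≡) refl
      (write-same (write s′ Jᴬ 0 (toℕ k)) rowᴬ (toℕ k) 0)

module _ {n m : ℕ} (I : Instance n m) where
  open Instance I

  record Context (s : Memory) : Set where
    field
      n≡         : s nᴬ 0 ≡ n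
      m≡         : s mᴬ 0 ≡ m
      p-array    : ∀ l → s pᴬ l ≡ array p l
      Γ-sound    : ∀ j i → s Γᴬ (s rowᴬ (toℕ j) + toℕ i) ≢ 0 → i ∈ˢ Γ j
      Γ-complete : ∀ j i → i ∈ˢ Γ j → s Γᴬ (s rowᴬ (toℕ j) + toℕ i) ≢ 0

  open Context

  p≡ : ∀ {s} → Context s → ∀ j → s pᴬ (toℕ j) ≡ p j
  p≡ ctx j = trans (p-array ctx (toℕ j)) (array-at p j)

  context-unchanged : ∀ c {s s′} → touchesContext c ≡ false → Unchanged c s s′ →
    Context s → Context s′
  context-unchanged c {s} {s′} eq same ctx = record
    { n≡ = trans (same nᴬ 0 eqn) (n≡ ctx)
    ; m≡ = trans (same mᴬ 0 eqm) (m≡ ctx)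
    ; p-array = λ l → trans (same pᴬ l eqp) (p-array ctx l)
    ; Γ-sound = λ j i ≢0 → Γ-sound ctx j i (≢0 ∘ trans (Γ≡ j i))
    ; Γ-complete = λ j i i∈ → Γ-complete ctx j i i∈ ∘ trans (sym (Γ≡ j i))
    }
    where
    eqn = ∨-falseˡ (writes c nᴬ) eq
    eq₁ = ∨-falseʳ (writes c nᴬ) eq
    eqm = ∨-falseˡ (writes c mᴬ) eq₁
    eq₂ = ∨-falseʳ (writes c mᴬ) eq₁
    eqp = ∨-falseˡ (writes c pᴬ) eq₂
    eq₃ = ∨-falseʳ (writes c pᴬ) eq₂
    eqΓ = ∨-falseˡ (writes c Γᴬ) eq₃
    eqr = ∨-falseʳ (writes c Γᴬ) eq₃
    Γ≡ : ∀ j i → s′ Γᴬ (s′ rowᴬ (toℕ j) + toℕ i) ≡ s Γᴬ (s rowᴬ (toℕ j) + toℕ i)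
    Γ≡ j i = trans (cong (λ x → s′ Γᴬ (x + toℕ i)) (same rowᴬ (toℕ j) eqr))
                   (same Γᴬ (s rowᴬ (toℕ j) + toℕ i) eqΓ)

  initial-context : ∀ π̂ → Context (run rows (input I π̂))
  initial-context π̂ = record
    { n≡ = trans (same nᴬ 0 refl) (array-at {1} (λ _ → n) zero)
    ; m≡ = trans (same mᴬ 0 refl) (array-at {1} (λ _ → m) zero)
    ; p-array = λ l → same pᴬ l refl
    ; Γ-sound = λ j i ≢0 → sound j i (≢0 ∘ trans (Γ≡ j i))
    ; Γ-complete = λ j i i∈ → complete j i i∈ ∘ trans (sym (Γ≡ j i))
    }
    where
    same : Unchanged rows (input I π̂) (run rows (input I π̂))
    same = run-unchanged rows (input I π̂)
    entry : Fin n → Fin m → ℕ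
    entry j i = if does (i ∈? Γ j) then 1 else 0
    sound : ∀ j i → entry j i ≢ 0 → i ∈ˢ Γ j
    sound j i ≢0 with i ∈? Γ j
    ... | yes i∈ = i∈
    ... | no  _  = contradiction refl ≢0
    complete : ∀ j i → i ∈ˢ Γ j → entry j i ≢ 0
    complete j i i∈ eq rewrite dec-true (i ∈? Γ j) i∈ = contradiction eq λ ()
    Γ≡ : ∀ j i → run rows (input I π̂) Γᴬ (run rows (input I π̂) rowᴬ (toℕ j) + toℕ i) ≡ entry j i
    Γ≡ j i = begin
      run rows (input I π̂) Γᴬ (run rows (input I π̂) rowᴬ (toℕ j) + toℕ i)
        ≡⟨ same Γᴬ _ refl ⟩
      input I π̂ Γᴬ (run rows (input I π̂) rowᴬ (toℕ j) + toℕ i)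
        ≡⟨ cong (input I π̂ Γᴬ) index ⟩
      input I π̂ Γᴬ (toℕ (combine j i))
        ≡⟨ array-at (uncurry entry ∘ remQuot {n} m) (combine j i) ⟩
      uncurry entry (remQuot {n} m (combine j i))
        ≡⟨ cong (uncurry entry) (Fin.remQuot-combine j i) ⟩
      entry j i ∎
      where
      open ≡-Reasoning
      index : run rows (input I π̂) rowᴬ (toℕ j) + toℕ i ≡ toℕ (combine j i)
      index = trans (cong (_+ toℕ i) (trans
        (rows-spec (input I π̂) (array-at {1} (λ _ → n) zero) j)
        (*-comm (toℕ j) m))) (sym (Fin.toℕ-combine j i))

  pick-spec : ∀ (j : Fin n) s → Context s → s Jᴬ 0 ≡ toℕ j →
    (∃ λ i → i ∈ˢ Γ j × run pick s σᴬ (toℕ j) ≡ toℕ i) ×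
    (∀ l → l ≢ toℕ j → run pick s σᴬ l ≡ s σᴬ l)
  pick-spec j s ctx j≡ = case for-rule P Iᴬ machines pick-step s (m≡ ctx) step
    (inj₂ (beyond _) , λ _ _ → refl) of λ where
      (inj₁ found , others) → found , others
      (inj₂ none , _) → contradiction (proj₂ (Γ-nonempty j)) (none (proj₁ (Γ-nonempty j)) z≤n)
    where
    P : ℕ → Memory → Set
    P k s′ = ((∃ λ i → i ∈ˢ Γ j × s′ σᴬ (toℕ j) ≡ toℕ i) ⊎ (∀ i → k ≤ toℕ i → ¬ i ∈ˢ Γ j)) ×
             (∀ l → l ≢ toℕ j → s′ σᴬ l ≡ s σᴬ l)
    step : ∀ (k : Fin m) s′ → Unchanged pick s s′ → P (suc (toℕ k)) s′ →
      P (toℕ k) (run pick-step (write s′ Iᴬ 0 (toℕ k)))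
    step k s′ same (choice , others) = when-rule (P (toℕ k)) (eligible (val Iᴬ)) pick-set nop
      (write s′ Iᴬ 0 (toℕ k))
      (λ ≢0 →
        inj₁ (k , Γ-sound ctx′ j k (subst (λ x → s′ Γᴬ (s′ rowᴬ x + toℕ k) ≢ 0) sJ ≢0) ,
          write-case (_≡ toℕ k) (write s′ Iᴬ 0 (toℕ k)) σᴬ (s′ Jᴬ 0) _ (toℕ j) (λ _ → refl)
            (λ j≢ → contradiction (sym sJ) j≢)) ,
        λ l l≢j → write-case (_≡ s σᴬ l) (write s′ Iᴬ 0 (toℕ k)) σᴬ (s′ Jᴬ 0) _ l
          (λ l≡ → contradiction (trans l≡ sJ) l≢j) (λ _ → others l l≢j))
      (λ ≡0 → (case choice of λ where
        (inj₁ found) → inj₁ found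
        (inj₂ none)  → inj₂ (extend (λ i → ¬ i ∈ˢ Γ j) k
          (λ k∈ → Γ-complete ctx′ j k k∈ (subst (λ x → s′ Γᴬ (s′ rowᴬ x + toℕ k) ≡ 0) sJ ≡0))
          none)) , others)
      where
      sJ : s′ Jᴬ 0 ≡ toℕ j
      sJ = trans (same Jᴬ 0 refl) j≡
      ctx′ = context-unchanged pick refl same ctx

  Placed : Memory → Assignment n m → Fin n → Fin m → Set
  Placed s τ j i = i ∈ˢ Γ j × (s θᴬ 0 < p j → τ j ∈ˢ Γ j → i ≡ τ j)

  prefer-spec : ∀ (j : Fin n) s τ → Context s → s Jᴬ 0 ≡ toℕ j → s τᴬ (toℕ j) ≡ toℕ (τ j) →
    (∃ λ i → i ∈ˢ Γ j × s σᴬ (toℕ j) ≡ toℕ i) →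
    (∃ λ i → Placed s τ j i × run prefer s σᴬ (toℕ j) ≡ toℕ i) ×
    (∀ l → l ≢ toℕ j → run prefer s σᴬ l ≡ s σᴬ l)
  prefer-spec j s τ ctx j≡ τ≡ (i , i∈ , σ≡) =
    when-rule P (pᴬ [ val Jᴬ ] ⊖ val θᴬ) prefer-eligible nop s
      (λ _ → when-rule P (eligible (τᴬ [ val Jᴬ ])) prefer-set nop s
        (λ ≢0 → (τ j , (Γ-sound ctx j (τ j) (λ ≡0 → ≢0 (trans entry≡ ≡0)) , λ _ _ → refl) ,
            write-case (_≡ toℕ (τ j)) s σᴬ (s Jᴬ 0) _ (toℕ j)
              (λ _ → τ-at) (λ j≢ → contradiction (sym j≡) j≢)) ,
          λ l l≢j → write-case (_≡ s σᴬ l) s σᴬ (s Jᴬ 0) _ l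
            (λ l≡ → contradiction (trans l≡ j≡) l≢j) (λ _ → refl))
        (λ ≡0 → (i , (i∈ , λ _ τ∈ → contradiction (trans (sym entry≡) ≡0)
          (Γ-complete ctx j (τ j) τ∈)) , σ≡) , λ _ _ → refl))
      (λ ≡0 → (i , (i∈ , λ θ<p _ → contradiction θ<p (≤⇒≯ (m∸n≡0⇒m≤n
        (subst (λ x → x ∸ s θᴬ 0 ≡ 0) (trans (cong (s pᴬ) j≡) (p≡ ctx j)) ≡0)))) , σ≡) ,
        λ _ _ → refl)
    where
    P : Memory → Set
    P s′ = (∃ λ i → Placed s τ j i × s′ σᴬ (toℕ j) ≡ toℕ i) × (∀ l → l ≢ toℕ j → s′ σᴬ l ≡ s σᴬ l)
    τ-at : s τᴬ (s Jᴬ 0) ≡ toℕ (τ j)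
    τ-at = trans (cong (s τᴬ) j≡) τ≡
    entry≡ : s Γᴬ (s rowᴬ (s Jᴬ 0) + s τᴬ (s Jᴬ 0)) ≡ s Γᴬ (s rowᴬ (toℕ j) + toℕ (τ j))
    entry≡ = cong (s Γᴬ) (cong₂ _+_ (cong (s rowᴬ) j≡) τ-at)

  start-spec : ∀ s τ → Context s → Holds s τᴬ τ →
    ∃ λ σ → Holds (run start s) σᴬ σ × (∀ j → Placed s τ j (σ j))
  start-spec s τ ctx τ≡ = (λ j → proj₁ (placed j z≤n)) ,
    (λ j → proj₂ (proj₂ (placed j z≤n))) , (λ j → proj₁ (proj₂ (placed j z≤n)))
    where
    Q : Memory → Fin n → Set
    Q s′ j = ∃ λ i → Placed s τ j i × s′ σᴬ (toℕ j) ≡ toℕ i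
    P : ℕ → Memory → Set
    P k s′ = ∀ j → k ≤ toℕ j → Q s′ j
    step : ∀ (k : Fin n) s′ → Unchanged start s s′ → P (suc (toℕ k)) s′ →
      P (toℕ k) (run start-body (write s′ Jᴬ 0 (toℕ k)))
    step k s′ same done = extend (Q (run prefer s₂)) k
      (let i , (i∈ , pref) , eq = proj₁ preferred in
        i , (i∈ , λ θ<p → pref (subst (_< p k) (sym θ-same) θ<p)) , eq)
      (λ i k<i → let i′ , pl , eq = done i k<i ; i≢k = <⇒≢ k<i ∘ sym in
        i′ , pl , trans (proj₂ preferred (toℕ i) i≢k) (trans (proj₂ picked (toℕ i) i≢k) eq))
      where
      s₁ = write s′ Jᴬ 0 (toℕ k)
      s₂ = run pick s₁
      ctx₁ : Context s₁
      ctx₁ = context-unchanged start refl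
        (λ b l eq → trans (write-other s′ Jᴬ 0 (toℕ k) b l (∨-falseˡ (does (b ≟ Jᴬ)) eq)) (same b l eq)) ctx
      picked = pick-spec k s₁ ctx₁ refl
      θ-same : s₂ θᴬ 0 ≡ s θᴬ 0
      θ-same = trans (run-keeps pick θᴬ refl s₁ 0) (same θᴬ 0 refl)
      preferred = prefer-spec k s₂ τ (context-unchanged pick refl (run-unchanged pick s₁) ctx₁)
        (run-keeps pick Jᴬ refl s₁ 0)
        (trans (run-keeps pick τᴬ refl s₁ (toℕ k)) (trans (same τᴬ (toℕ k) refl) (τ≡ k)))
        (proj₁ picked)
    placed : P 0 (run start s)
    placed = for-rule P Jᴬ jobs start-body s (n≡ ctx) step (λ j → beyond (Q (write s Jᴬ 0 n)) j)

  clear-spec : ∀ a → does (a ≟ Iᴬ) ≡ false → ∀ s → Context s →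
    ∀ (i : Fin m) → run (clear a) s a (toℕ i) ≡ 0
  clear-spec a a≠I s ctx i = for-rule P Iᴬ machines (zero-entry a) s (m≡ ctx) step (beyond _) i z≤n
    where
    P : ℕ → Memory → Set
    P k s′ = ∀ (i : Fin m) → k ≤ toℕ i → s′ a (toℕ i) ≡ 0
    step : ∀ (k : Fin m) s′ → Unchanged (clear a) s s′ → P (suc (toℕ k)) s′ →
      P (toℕ k) (write (write s′ Iᴬ 0 (toℕ k)) a (toℕ k) 0)
    step k s′ same done = extend _ k (write-same (write s′ Iᴬ 0 (toℕ k)) a (toℕ k) 0)
      λ i k<i → write-case (_≡ 0) (write s′ Iᴬ 0 (toℕ k)) a (toℕ k) 0 (toℕ i)
        (λ _ → refl) (λ _ → trans (write-other s′ Iᴬ 0 (toℕ k) a (toℕ i) a≠I) (done i k<i))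

  load-add-spec : ∀ s σ → Context s → Holds s σᴬ σ → (∀ (i : Fin m) → s loadᴬ (toℕ i) ≡ 0) →
    ∀ i → run load-add s loadᴬ (toℕ i) ≡ load I σ i
  load-add-spec s σ ctx σ≡ zeros i = trans (sym (+-identityʳ _))
    (trans (cong (run load-add s loadᴬ (toℕ i) +_) (sym (partial-zero (share i))))
      (for-rule P Jᴬ jobs load-increase s (n≡ ctx) step
        (λ i → cong₂ _+_ (zeros i) (partial-all (share i))) i))
    where
    share : Fin m → Fin n → ℕ
    share i j = if does (σ j Fin.≟ i) then p j else 0
    P : ℕ → Memory → Set
    P k s′ = ∀ i → s′ loadᴬ (toℕ i) + partial (share i) k ≡ load I σ i
    step : ∀ (k : Fin n) s′ → Unchanged load-add s s′ → P (suc (toℕ k)) s′ →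
      P (toℕ k) (run load-increase (write s′ Jᴬ 0 (toℕ k)))
    step k s′ same done i = write-case (λ x → x + partial (share i) (toℕ k) ≡ load I σ i)
      (write s′ Jᴬ 0 (toℕ k)) loadᴬ (s′ σᴬ (toℕ k)) _ (toℕ i)
      (λ i≡ → let σk≡i = sym (Fin.toℕ-injective (trans i≡ σk)) in
        trans (cong₂ (λ x y → x + y + partial (share i) (toℕ k))
                (cong (s′ loadᴬ) (sym i≡)) (trans pk (sym (mine σk≡i))))
        (trans (+-assoc (s′ loadᴬ (toℕ i)) (share i k) _) unfolded))
      (λ i≢ → trans (cong (λ x → s′ loadᴬ (toℕ i) + (x + partial (share i) (toℕ k)))
                (sym (other λ σk≡i → i≢ (trans (cong toℕ (sym σk≡i)) (sym σk))))) unfolded)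
      where
      σk : s′ σᴬ (toℕ k) ≡ toℕ (σ k)
      σk = trans (same σᴬ (toℕ k) refl) (σ≡ k)
      pk : s′ pᴬ (toℕ k) ≡ p k
      pk = trans (same pᴬ (toℕ k) refl) (p≡ ctx k)
      mine : σ k ≡ i → share i k ≡ p k
      mine eq rewrite dec-true (σ k Fin.≟ i) eq = refl
      other : σ k ≢ i → share i k ≡ 0
      other ≢ rewrite dec-false (σ k Fin.≟ i) ≢ = refl
      unfolded : s′ loadᴬ (toℕ i) + (share i k + partial (share i) (toℕ k)) ≡ load I σ i
      unfolded = trans (cong (s′ loadᴬ (toℕ i) +_) (sym (partial-suc (share i) k))) (done i)

  loads-spec : ∀ s σ → Context s → Holds s σᴬ σ → ∀ i → run loads s loadᴬ (toℕ i) ≡ load I σ i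
  loads-spec s σ ctx σ≡ = load-add-spec (run (clear loadᴬ) s) σ
    (context-unchanged (clear loadᴬ) refl (run-unchanged (clear loadᴬ) s) ctx)
    (λ j → trans (run-keeps (clear loadᴬ) σᴬ refl s (toℕ j)) (σ≡ j))
    (clear-spec loadᴬ refl s ctx)

  evaluate-spec : ∀ s σ → Context s → Holds s σᴬ σ → run evaluate s maxᴬ 0 ≡ Cmax I σ
  evaluate-spec s σ ctx σ≡ = ≤-antisym (proj₂ result) (Max≤ (load I σ) λ i → proj₁ result i z≤n)
    where
    s₁ = run loads s
    s₂ = write s₁ maxᴬ 0 0
    P : ℕ → Memory → Set
    P k s′ = (∀ i → k ≤ toℕ i → load I σ i ≤ s′ maxᴬ 0) × s′ maxᴬ 0 ≤ Cmax I σ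
    step : ∀ (k : Fin m) s′ → Unchanged max-loop s₂ s′ → P (suc (toℕ k)) s′ →
      P (toℕ k) (run max-step (write s′ Iᴬ 0 (toℕ k)))
    step k s′ same (lower , upper) = when-rule (P (toℕ k)) (loadᴬ [ val Iᴬ ] ⊖ val maxᴬ) max-set nop
      (write s′ Iᴬ 0 (toℕ k))
      (λ ≢0 → extend (λ i → load I σ i ≤ s′ loadᴬ (toℕ k)) k (≤-reflexive (sym at-k))
          (λ i k<i → ≤-trans (lower i k<i) (<⇒≤ (m∸n≢0⇒n<m ≢0))) ,
        subst (_≤ Cmax I σ) (sym at-k) (≤Max (load I σ) k))
      (λ ≡0 → extend (λ i → load I σ i ≤ s′ maxᴬ 0) k
          (subst (_≤ s′ maxᴬ 0) at-k (m∸n≡0⇒m≤n ≡0)) lower , upper)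
      where
      at-k : s′ loadᴬ (toℕ k) ≡ load I σ k
      at-k = trans (same loadᴬ (toℕ k) refl) (loads-spec s σ ctx σ≡ k)
    result : P 0 (run evaluate s)
    result = for-rule P Iᴬ machines max-step s₂
      (trans (run-keeps loads mᴬ refl s 0) (m≡ ctx)) step (beyond _ , z≤n)

-- A step of push–relabel

obstacle : Exp
obstacle =
  (pᴬ [ val Jᴬ ] ⊖ val θᴬ) ⊕ ((lit 1 ⊖ eligible (val Iᴬ)) ⊕
  (((lit 1 ⊕ (val Tᴬ ⊕ val θᴬ)) ⊖ loadᴬ [ σᴬ [ val Jᴬ ] ]) ⊕
   ((lit 1 ⊕ dᴬ [ val Iᴬ ]) ⊖ dᴬ [ σᴬ [ val Jᴬ ] ])))

search-hit search-step search-machines search : Cmd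
search-hit      = foundᴬ [ lit 0 ]:= lit 1 ⨟ (jᴬ [ lit 0 ]:= val Jᴬ ⨟ vᴬ [ lit 0 ]:= val Iᴬ)
search-step     = when obstacle then nop otherwise search-hit
search-machines = for Iᴬ below machines repeat search-step
search          = for Jᴬ below jobs repeat search-machines

over-hit over-step over : Cmd
over-hit  = uᴬ [ lit 0 ]:= lit 1 ⊕ val Iᴬ
over-step = when loadᴬ [ val Iᴬ ] ⊖ (val Tᴬ ⊕ val θᴬ) then over-hit otherwise nop
over      = for Iᴬ below machines repeat over-step

push-act relabel-act relabel-cmd act prepare step : Cmd
push-act    = σᴬ [ val jᴬ ]:= val vᴬ
relabel-act = dᴬ [ val uᴬ ⊖ lit 1 ]:= lit 1 ⊕ dᴬ [ val uᴬ ⊖ lit 1 ]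
relabel-cmd = when val uᴬ then relabel-act otherwise nop
act         = when val foundᴬ then push-act otherwise relabel-cmd
prepare     = loads ⨟ (foundᴬ [ lit 0 ]:= lit 0 ⨟ uᴬ [ lit 0 ]:= lit 0)
step        = prepare ⨟ (search ⨟ (over ⨟ act))

module _ {n m : ℕ} (I : Instance n m) where
  open Instance I
  open Context

  context-run : ∀ c s → touchesContext c ≡ false → Context I s → Context I (run c s)
  context-run c s eq = context-unchanged I c eq (run-unchanged c s)

  labels : Memory → Fin m → ℕ
  labels s i = s dᴬ (toℕ i)

  record Snapshot (s : Memory) (σ : Assignment n m) : Set where
    field
      context : Context I s
      σ≡      : Holds s σᴬ σ
      load≡   : ∀ i → s loadᴬ (toℕ i) ≡ load I σ i

  open Snapshot

  touchesSnapshot : Cmd → Bool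
  touchesSnapshot c = touchesContext c ∨ (writes c σᴬ ∨ writes c loadᴬ)

  snapshot-unchanged : ∀ c {s s′ σ} → touchesSnapshot c ≡ false → Unchanged c s s′ →
    Snapshot s σ → Snapshot s′ σ
  snapshot-unchanged c eq same snap = record
    { context = context-unchanged I c (∨-falseˡ (touchesContext c) eq) same (context snap)
    ; σ≡ = λ j → trans (same σᴬ (toℕ j) (∨-falseˡ (writes c σᴬ) eq₁)) (σ≡ snap j)
    ; load≡ = λ i → trans (same loadᴬ (toℕ i) (∨-falseʳ (writes c σᴬ) eq₁)) (load≡ snap i)
    }
    where
    eq₁ = ∨-falseʳ (touchesContext c) eq

  Pushable : Memory → Assignment n m → Fin n → Fin m → Set
  Pushable s σ = Admissible I (s Tᴬ 0) (s θᴬ 0) σ (labels s)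

  touchesLabels : Cmd → Bool
  touchesLabels c = writes c Tᴬ ∨ (writes c θᴬ ∨ writes c dᴬ)

  pushable-unchanged : ∀ c {s s′ σ j v} → touchesLabels c ≡ false → Unchanged c s s′ →
    (Pushable s′ σ j v → Pushable s σ j v) × (Pushable s σ j v → Pushable s′ σ j v)
  pushable-unchanged c {s} {s′} {σ} {j} {v} eq same =
    (λ (a , b , o , e) → subst (p j ≤_) θ≡ a , b ,
       subst₂ (λ t h → t + h < load I σ (σ j)) T≡ θ≡ o , subst₂ _<_ (d≡ v) (d≡ (σ j)) e) ,
    (λ (a , b , o , e) → subst (p j ≤_) (sym θ≡) a , b ,
       subst₂ (λ t h → t + h < load I σ (σ j)) (sym T≡) (sym θ≡) o ,
       subst₂ _<_ (sym (d≡ v)) (sym (d≡ (σ j))) e)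
    where
    eq₁ = ∨-falseʳ (writes c Tᴬ) eq
    T≡ = same Tᴬ 0 (∨-falseˡ (writes c Tᴬ) eq)
    θ≡ = same θᴬ 0 (∨-falseˡ (writes c θᴬ) eq₁)
    d≡ : ∀ i → labels s′ i ≡ labels s i
    d≡ i = same dᴬ (toℕ i) (∨-falseʳ (writes c θᴬ) eq₁)

  obstacle-spec : ∀ s σ j v → Snapshot s σ → s Jᴬ 0 ≡ toℕ j → s Iᴬ 0 ≡ toℕ v →
    (eval s obstacle ≡ 0 → Pushable s σ j v) × (Pushable s σ j v → eval s obstacle ≡ 0)
  obstacle-spec s σ j v snap j≡ v≡ = to , from
    where
    pj : s pᴬ (s Jᴬ 0) ≡ p j
    pj = trans (cong (s pᴬ) j≡) (p≡ I (context snap) j)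
    σj : s σᴬ (s Jᴬ 0) ≡ toℕ (σ j)
    σj = trans (cong (s σᴬ) j≡) (σ≡ snap j)
    lj : s loadᴬ (s σᴬ (s Jᴬ 0)) ≡ load I σ (σ j)
    lj = trans (cong (s loadᴬ) σj) (load≡ snap (σ j))
    dj : s dᴬ (s σᴬ (s Jᴬ 0)) ≡ labels s (σ j)
    dj = cong (s dᴬ) σj
    dv : s dᴬ (s Iᴬ 0) ≡ labels s v
    dv = cong (s dᴬ) v≡
    Γjv : s Γᴬ (s rowᴬ (s Jᴬ 0) + s Iᴬ 0) ≡ s Γᴬ (s rowᴬ (toℕ j) + toℕ v)
    Γjv = cong (s Γᴬ) (cong₂ _+_ (cong (s rowᴬ) j≡) v≡)
    value : eval s obstacle ≡
      (p j ∸ s θᴬ 0) + ((1 ∸ s Γᴬ (s rowᴬ (toℕ j) + toℕ v)) +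
      ((suc (s Tᴬ 0 + s θᴬ 0) ∸ load I σ (σ j)) + (suc (labels s v) ∸ labels s (σ j))))
    value = cong₂ _+_ (cong (_∸ s θᴬ 0) pj) (cong₂ _+_ (cong (1 ∸_) Γjv)
      (cong₂ _+_ (cong (suc (s Tᴬ 0 + s θᴬ 0) ∸_) lj) (cong₂ _∸_ (cong suc dv) dj)))
    to : eval s obstacle ≡ 0 → Pushable s σ j v
    to ≡0 =
      m∸n≡0⇒m≤n (m+n≡0⇒m≡0 A total) ,
      Γ-sound (context snap) j v (λ Γ≡0 → <⇒≢ (m∸n≡0⇒m≤n {1} (m+n≡0⇒m≡0 B rest)) (sym Γ≡0)) ,
      m∸n≡0⇒m≤n (m+n≡0⇒m≡0 C rest′) ,
      m∸n≡0⇒m≤n (m+n≡0⇒n≡0 C rest′)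
      where
      A = p j ∸ s θᴬ 0
      B = 1 ∸ s Γᴬ (s rowᴬ (toℕ j) + toℕ v)
      C = suc (s Tᴬ 0 + s θᴬ 0) ∸ load I σ (σ j)
      total = trans (sym value) ≡0
      rest = m+n≡0⇒n≡0 A total
      rest′ = m+n≡0⇒n≡0 B rest
    from : Pushable s σ j v → eval s obstacle ≡ 0
    from (p≤ , v∈ , o , e) = trans value (cong₂ _+_ (m≤n⇒m∸n≡0 p≤) (cong₂ _+_
      (m≤n⇒m∸n≡0 (n≢0⇒n>0 (Γ-complete (context snap) j v v∈)))
      (cong₂ _+_ (m≤n⇒m∸n≡0 o) (m≤n⇒m∸n≡0 e))))

  module Search (s : Memory) (σ : Assignment n m) (snap : Snapshot s σ) where

    Hit : Memory → Set
    Hit s′ = s′ foundᴬ 0 ≢ 0 ×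
      ∃ λ j → ∃ λ v → s′ jᴬ 0 ≡ toℕ j × s′ vᴬ 0 ≡ toℕ v × Pushable s σ j v

    search-machines-spec : ∀ (X : Set) j s₁ → Unchanged search s s₁ → s₁ Jᴬ 0 ≡ toℕ j →
      (s₁ foundᴬ 0 ≡ 0 × X) ⊎ Hit s₁ →
      (run search-machines s₁ foundᴬ 0 ≡ 0 × X × (∀ v → ¬ Pushable s σ j v)) ⊎ Hit (run search-machines s₁)
    search-machines-spec X j s₁ same₁ j≡ init =
      case for-rule P Iᴬ machines search-step s₁ (trans (same₁ mᴬ 0 refl) (m≡ (context snap))) body base
      of λ where
        (inj₁ (f≡0 , x , none)) → inj₁ (f≡0 , x , λ v → none v z≤n)
        (inj₂ hit) → inj₂ hit
      where
      P : ℕ → Memory → Set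
      P k s′ = (s′ foundᴬ 0 ≡ 0 × X × (∀ v → k ≤ toℕ v → ¬ Pushable s σ j v)) ⊎ Hit s′
      base : P m (write s₁ Iᴬ 0 m)
      base = case init of λ where
        (inj₁ (f≡0 , x)) → inj₁ (f≡0 , x , λ v → beyond (λ v → ¬ Pushable s σ j v) v)
        (inj₂ hit) → inj₂ hit
      body : ∀ (k : Fin m) s′ → Unchanged search-machines s₁ s′ → P (suc (toℕ k)) s′ →
        P (toℕ k) (run search-step (write s′ Iᴬ 0 (toℕ k)))
      body k s′ same inv = when-rule (P (toℕ k)) obstacle nop search-hit s₂
        (λ ≢0 → case inv of λ where
          (inj₁ (f≡0 , x , none)) → inj₁ (f≡0 , x , extend (λ v → ¬ Pushable s σ j v) k
            (λ pushable → ≢0 (proj₂ spec (proj₂ moved pushable))) none)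
          (inj₂ hit) → inj₂ hit)
        (λ ≡0 → inj₂ ((λ ()) , j , k , trans (same Jᴬ 0 refl) j≡ , refl , proj₁ moved (proj₁ spec ≡0)))
        where
        s₂ = write s′ Iᴬ 0 (toℕ k)
        same₂ : Unchanged search s s₂
        same₂ b l eq = trans (write-other s′ Iᴬ 0 (toℕ k) b l (∨-falseˡ (does (b ≟ Iᴬ)) eqᵢ))
          (trans (same b l eqᵢ) (same₁ b l eq))
          where eqᵢ = ∨-falseʳ (does (b ≟ Jᴬ)) eq
        moved = pushable-unchanged search {s} {s₂} {σ} {j} {k} refl same₂
        spec = obstacle-spec s₂ σ j k (snapshot-unchanged search refl same₂ snap)
          (trans (same Jᴬ 0 refl) j≡) refl

    search-spec : s foundᴬ 0 ≡ 0 →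
      (run search s foundᴬ 0 ≡ 0 × (∀ j v → ¬ Pushable s σ j v)) ⊎ Hit (run search s)
    search-spec f≡0 =
      case for-rule P Jᴬ jobs search-machines s (n≡ (context snap)) body
        (inj₁ (f≡0 , λ j n≤j v → beyond (λ j → ¬ Pushable s σ j v) j n≤j))
      of λ where
        (inj₁ (f≡0 , none)) → inj₁ (f≡0 , λ j → none j z≤n)
        (inj₂ hit) → inj₂ hit
      where
      P : ℕ → Memory → Set
      P k s′ = (s′ foundᴬ 0 ≡ 0 × (∀ j → k ≤ toℕ j → ∀ v → ¬ Pushable s σ j v)) ⊎ Hit s′
      body : ∀ (k : Fin n) s′ → Unchanged search s s′ → P (suc (toℕ k)) s′ →
        P (toℕ k) (run search-machines (write s′ Jᴬ 0 (toℕ k)))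
      body k s′ same inv = case search-machines-spec _ k (write s′ Jᴬ 0 (toℕ k)) same₁ refl inv of λ where
          (inj₁ (f≡0 , rest , none)) →
            inj₁ (f≡0 , extend (λ j → ∀ v → ¬ Pushable s σ j v) k none rest)
          (inj₂ hit) → inj₂ hit
        where
        same₁ : Unchanged search s (write s′ Jᴬ 0 (toℕ k))
        same₁ b l eq = trans (write-other s′ Jᴬ 0 (toℕ k) b l (∨-falseˡ (does (b ≟ Jᴬ)) eq)) (same b l eq)

  over-spec : ∀ s σ → Snapshot s σ → s uᴬ 0 ≡ 0 →
    (run over s uᴬ 0 ≡ 0 × (∀ i → ¬ Overloaded I (s Tᴬ 0) (s θᴬ 0) σ i)) ⊎
    (∃ λ i → run over s uᴬ 0 ≡ suc (toℕ i) × Overloaded I (s Tᴬ 0) (s θᴬ 0) σ i)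
  over-spec s σ snap u≡0 =
    case for-rule P Iᴬ machines over-step s (m≡ (context snap)) body (inj₁ (u≡0 , beyond Fine)) of λ where
      (inj₁ (u≡0 , none)) → inj₁ (u≡0 , λ i → none i z≤n)
      (inj₂ hit) → inj₂ hit
    where
    Fine : Fin m → Set
    Fine i = ¬ Overloaded I (s Tᴬ 0) (s θᴬ 0) σ i
    P : ℕ → Memory → Set
    P k s′ = (s′ uᴬ 0 ≡ 0 × (∀ i → k ≤ toℕ i → Fine i)) ⊎
             (∃ λ i → s′ uᴬ 0 ≡ suc (toℕ i) × Overloaded I (s Tᴬ 0) (s θᴬ 0) σ i)
    body : ∀ (k : Fin m) s′ → Unchanged over s s′ → P (suc (toℕ k)) s′ →
      P (toℕ k) (run over-step (write s′ Iᴬ 0 (toℕ k)))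
    body k s′ same inv = when-rule (P (toℕ k)) (loadᴬ [ val Iᴬ ] ⊖ (val Tᴬ ⊕ val θᴬ)) over-hit nop
      (write s′ Iᴬ 0 (toℕ k))
      (λ ≢0 → inj₂ (k , refl , subst₂ _<_ T+θ load-k (m∸n≢0⇒n<m ≢0)))
      (λ ≡0 → case inv of λ where
        (inj₁ (u≡0 , none)) → inj₁ (u≡0 , extend Fine k
          (≤⇒≯ (subst₂ _≤_ load-k T+θ (m∸n≡0⇒m≤n ≡0))) none)
        (inj₂ hit) → inj₂ hit)
      where
      T+θ : s′ Tᴬ 0 + s′ θᴬ 0 ≡ s Tᴬ 0 + s θᴬ 0
      T+θ = cong₂ _+_ (same Tᴬ 0 refl) (same θᴬ 0 refl)
      load-k : s′ loadᴬ (toℕ k) ≡ load I σ k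
      load-k = trans (same loadᴬ (toℕ k) refl) (load≡ snap k)

  StepsTo : Memory → Assignment n m → Memory → Set
  StepsTo s σ s′ = ∃ λ σ′ → Holds s′ σᴬ σ′ ×
    Step I (s Tᴬ 0) (s θᴬ 0) σ (labels s) σ′ (labels s′)

  step-spec : ∀ s σ → Context I s → Holds s σᴬ σ → StepsTo s σ (run step s)
  step-spec s σ ctx σ≡₀ = acted
    where
    s₁ = run prepare s
    s₂ = run search s₁
    s₃ = run over s₂
    snap₁ : Snapshot s₁ σ
    snap₁ = record
      { context = context-run prepare s refl ctx
      ; σ≡ = λ j → trans (run-keeps prepare σᴬ refl s (toℕ j)) (σ≡₀ j)
      ; load≡ = loads-spec I s σ ctx σ≡₀ }
    snap₂ : Snapshot s₂ σ
    snap₂ = snapshot-unchanged search refl (run-unchanged search s₁) snap₁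
    kept : ∀ b l → writes (prepare ⨟ (search ⨟ over)) b ≡ false → s₃ b l ≡ s b l
    kept = run-unchanged (prepare ⨟ (search ⨟ over)) s
    pushable₁ : ∀ j v → (Pushable s₁ σ j v → Pushable s σ j v) × (Pushable s σ j v → Pushable s₁ σ j v)
    pushable₁ j v = pushable-unchanged prepare {s} {s₁} {σ} {j} {v} refl (run-unchanged prepare s)
    overs : (s₃ uᴬ 0 ≡ 0 × (∀ i → ¬ Overloaded I (s Tᴬ 0) (s θᴬ 0) σ i)) ⊎
      (∃ λ i → s₃ uᴬ 0 ≡ suc (toℕ i) × Overloaded I (s Tᴬ 0) (s θᴬ 0) σ i)
    overs = subst₂ (λ t h → (s₃ uᴬ 0 ≡ 0 × (∀ i → ¬ Overloaded I t h σ i)) ⊎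
        (∃ λ i → s₃ uᴬ 0 ≡ suc (toℕ i) × Overloaded I t h σ i))
      (run-keeps (prepare ⨟ search) Tᴬ refl s 0) (run-keeps (prepare ⨟ search) θᴬ refl s 0)
      (over-spec s₂ σ snap₂ (run-keeps search uᴬ refl s₁ 0))
    found≡ : s₃ foundᴬ 0 ≡ s₂ foundᴬ 0
    found≡ = run-keeps over foundᴬ refl s₂ 0
    σ₃ : Holds s₃ σᴬ σ
    σ₃ j = trans (kept σᴬ (toℕ j) refl) (σ≡₀ j)
    d₃ : ∀ i → labels s₃ i ≡ labels s i
    d₃ i = kept dᴬ (toℕ i) refl
    acted : StepsTo s σ (run act s₃)
    acted = when-rule (StepsTo s σ) (val foundᴬ) push-act relabel-cmd s₃
      (λ f≢0 → case Search.search-spec s₁ σ snap₁ refl of λ where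
        (inj₁ (f≡0 , _)) → contradiction (trans found≡ f≡0) f≢0
        (inj₂ (_ , j , v , j≡ , v≡ , pushable)) → pushed j v
          (trans (run-keeps over jᴬ refl s₂ 0) j≡) (trans (run-keeps over vᴬ refl s₂ 0) v≡)
          (proj₁ (pushable₁ j v) pushable))
      (λ f≡0 → when-rule (StepsTo s σ) (val uᴬ) relabel-act nop s₃
        (λ u≢0 → case overs of λ where
          (inj₁ (u≡0 , _)) → contradiction u≡0 u≢0
          (inj₂ (i , u≡ , heavy)) → relabelled i u≡ heavy (stuck f≡0))
        (λ u≡0 → case overs of λ where
          (inj₁ (_ , none)) → σ , σ₃ , stay none (λ _ → refl) d₃
          (inj₂ (_ , u≡ , _)) → contradiction (trans (sym u≡0) u≡) λ ()))
      where
      stuck : s₃ foundᴬ 0 ≡ 0 → ∀ j v → ¬ Pushable s σ j v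
      stuck f≡0 j v pushable = case Search.search-spec s₁ σ snap₁ refl of λ where
        (inj₁ (_ , none)) → none j v (proj₂ (pushable₁ j v) pushable)
        (inj₂ (f≢0 , _)) → f≢0 (trans (sym found≡) f≡0)
      pushed : ∀ j v → s₃ jᴬ 0 ≡ toℕ j → s₃ vᴬ 0 ≡ toℕ v → Pushable s σ j v →
        StepsTo s σ (run push-act s₃)
      pushed j v j≡ v≡ pushable = updateAt σ j (const v) , holds , push j v pushable
        (updateAt-updates j σ) (λ k k≢j → updateAt-minimal k j σ k≢j) d₃
        where
        holds : Holds (run push-act s₃) σᴬ (updateAt σ j (const v))
        holds k = write-case (_≡ toℕ (updateAt σ j (const v) k)) s₃ σᴬ (s₃ jᴬ 0) (s₃ vᴬ 0) (toℕ k)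
          (λ k≡ → trans v≡ (cong toℕ (sym (trans
            (cong (updateAt σ j (const v)) (Fin.toℕ-injective (trans k≡ j≡))) (updateAt-updates j σ)))))
          (λ k≢ → trans (σ₃ k) (cong toℕ (sym (updateAt-minimal k j σ
            λ k≡j → k≢ (trans (cong toℕ k≡j) (sym j≡))))))
      relabelled : ∀ i → s₃ uᴬ 0 ≡ suc (toℕ i) → Overloaded I (s Tᴬ 0) (s θᴬ 0) σ i →
        (∀ j v → ¬ Pushable s σ j v) → StepsTo s σ (run relabel-act s₃)
      relabelled i u≡ heavy stuck = σ , σ₃ , relabel i heavy stuck (λ _ → refl)
        (write-case (_≡ suc (labels s i)) s₃ dᴬ (s₃ uᴬ 0 ∸ 1) _ (toℕ i)
          (λ i≡ → cong suc (trans (cong (s₃ dᴬ) (sym i≡)) (d₃ i)))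
          (λ i≢ → contradiction (sym (cong (_∸ 1) u≡)) i≢))
        (λ v v≢i → write-case (_≡ labels s v) s₃ dᴬ (s₃ uᴬ 0 ∸ 1) _ (toℕ v)
          (λ v≡ → contradiction (Fin.toℕ-injective (trans v≡ (cong (_∸ 1) u≡))) v≢i)
          (λ _ → d₃ v))

-- Rounds of push–relabel for guessed thresholds

baseᴬ : Name
baseᴬ = 19

-- base ∸ K · θ, without multiplication.
T-lower T-step T-loop set-T : Cmd
T-lower = Tᴬ [ lit 0 ]:= val Tᴬ ⊖ val θᴬ
T-step  = when val Kᴬ ⊖ val Iᴬ then T-lower otherwise nop
T-loop  = for Iᴬ below jobs repeat T-step
set-T   = Tᴬ [ lit 0 ]:= val baseᴬ ⨟ T-loop

steps₁ steps₂ steps : Cmd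
steps₁ = for Aᴬ below machines repeat step
steps₂ = for Bᴬ below machines repeat steps₁
steps  = for Cᴬ below jobs ∔ (jobs ∔ jobs) repeat steps₂

copy-entry copy : Name → Name → Cmd
copy-entry a b = a [ val Jᴬ ]:= b [ val Jᴬ ]
copy a b       = for Jᴬ below jobs repeat copy-entry a b

record-best improve setup attempt : Cmd
record-best = bestᴬ [ lit 0 ]:= val maxᴬ ⨟ copy outᴬ σᴬ
improve     = when val bestᴬ ⊖ val maxᴬ then record-best otherwise nop
setup       = start ⨟ (set-T ⨟ clear dᴬ)
attempt     = setup ⨟ (steps ⨟ (evaluate ⨟ improve))

threshold-setup attempts threshold-body thresholds : Cmd
threshold-setup =
  θᴬ [ lit 0 ]:= pᴬ [ val Qᴬ ] ⨟ (start ⨟ (evaluate ⨟ baseᴬ [ lit 0 ]:= val maxᴬ))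
attempts        = for Kᴬ below one ∔ jobs repeat attempt
threshold-body  = threshold-setup ⨟ attempts
thresholds      = for Qᴬ below one ∔ jobs repeat threshold-body

repeat-rule : ∀ (W : ℕ → Memory → Set) x r c w →
  (∀ i s k → W i s → W (w + i) (run c (write s x 0 k))) →
  ∀ i s {N} → eval s ⌜ r ⌝ ≡ N → W i (write s x 0 N) →
  W (N * w + i) (run (for x below r repeat c) s)
repeat-rule W x r c w body i s {N} refl start = go N i (write s x 0 N) start
  where
  go : ∀ k i s → W i s → W (k * w + i) (countdown (run c) x k s)
  go zero    i s Wi = Wi
  go (suc k) i s Wi = subst (λ j → W j (countdown (run c) x k (run c (write s x 0 k))))
    (trans (sym (+-assoc (k * w) w i)) (cong (_+ i) (+-comm (k * w) w)))
    (go k (w + i) (run c (write s x 0 k)) (body i s k Wi))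

module _ {n m : ℕ} (I : Instance n m) where
  open Instance I
  open Context

  set-T-spec : ∀ s → Context I s → s Kᴬ 0 ≤ n →
    run set-T s Tᴬ 0 ≡ s baseᴬ 0 ∸ s Kᴬ 0 * s θᴬ 0
  set-T-spec s ctx K≤n = for-rule P Iᴬ jobs T-step s₁ (n≡ ctx) body
    (cong (λ x → s baseᴬ 0 ∸ x * s θᴬ 0) (sym (m≤n⇒m∸n≡0 K≤n)))
    where
    s₁ = write s Tᴬ 0 (s baseᴬ 0)
    P : ℕ → Memory → Set
    P k s′ = s′ Tᴬ 0 ≡ s baseᴬ 0 ∸ (s Kᴬ 0 ∸ k) * s θᴬ 0
    body : ∀ (k : Fin n) s′ → Unchanged T-loop s₁ s′ → P (suc (toℕ k)) s′ →
      P (toℕ k) (run T-step (write s′ Iᴬ 0 (toℕ k)))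
    body k s′ same T≡ = when-rule (P (toℕ k)) (val Kᴬ ⊖ val Iᴬ) T-lower nop (write s′ Iᴬ 0 (toℕ k))
      (λ ≢0 → begin
        s′ Tᴬ 0 ∸ s′ θᴬ 0
          ≡⟨ cong₂ _∸_ T≡ (same θᴬ 0 refl) ⟩
        s baseᴬ 0 ∸ (s Kᴬ 0 ∸ suc (toℕ k)) * s θᴬ 0 ∸ s θᴬ 0
          ≡⟨ ∸-+-assoc (s baseᴬ 0) ((s Kᴬ 0 ∸ suc (toℕ k)) * s θᴬ 0) (s θᴬ 0) ⟩
        s baseᴬ 0 ∸ ((s Kᴬ 0 ∸ suc (toℕ k)) * s θᴬ 0 + s θᴬ 0)
          ≡⟨ cong (s baseᴬ 0 ∸_) (+-comm ((s Kᴬ 0 ∸ suc (toℕ k)) * s θᴬ 0) (s θᴬ 0)) ⟩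
        s baseᴬ 0 ∸ suc (s Kᴬ 0 ∸ suc (toℕ k)) * s θᴬ 0
          ≡⟨ cong (λ x → s baseᴬ 0 ∸ x * s θᴬ 0)
               (+-∸-assoc 1 (m∸n≢0⇒n<m {s Kᴬ 0} {toℕ k} (subst (λ x → x ∸ toℕ k ≢ 0) K≡ ≢0))) ⟨
        s baseᴬ 0 ∸ (s Kᴬ 0 ∸ toℕ k) * s θᴬ 0 ∎)
      (λ ≡0 → let K≤k = m∸n≡0⇒m≤n {s Kᴬ 0} {toℕ k} (subst (λ x → x ∸ toℕ k ≡ 0) K≡ ≡0) in
        trans T≡ (cong (λ x → s baseᴬ 0 ∸ x * s θᴬ 0)
          (trans (m≤n⇒m∸n≡0 (m≤n⇒m≤1+n K≤k)) (sym (m≤n⇒m∸n≡0 K≤k)))))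
      where
      open ≡-Reasoning
      K≡ : s′ Kᴬ 0 ≡ s Kᴬ 0
      K≡ = same Kᴬ 0 refl

  GoodStart : ℕ → ℕ → Assignment n m → Assignment n m → Set
  GoodStart T θ σ σ* = Feasible I σ* × (∀ i → load I σ* i ≤ T) × (∀ j → θ < p j → σ j ≡ σ* j)

  enough-steps : ∀ {n m} → 1 ≤ n → 1 ≤ m → m * m + n * (m * m) < (n + (n + n)) * (m * (m * 1)) + 0
  enough-steps {n} {m} 1≤n 1≤m = begin-strict
    m * m + n * (m * m)                ≡⟨⟩
    suc n * (m * m)                    <⟨ *-monoˡ-< (m * m) {{>-nonZero (*-mono-≤ 1≤m 1≤m)}}
                                            (+-mono-≤ 1≤n (+-mono-≤ 1≤n ≤-refl)) ⟩
    (n + (n + n)) * (m * m)            ≡⟨ solve 2 (λ a b → a :* (b :* b) :=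
                                            a :* (b :* (b :* con 1)) :+ con 0) refl (n + (n + n)) m ⟩
    (n + (n + n)) * (m * (m * 1)) + 0 ∎
    where
    open ≤-Reasoning

  steps-spec : 1 ≤ n → 1 ≤ m → ∀ s σ₀ → Context I s → Holds s σᴬ σ₀ → Feasible I σ₀ →
    (∀ i → labels I s i ≡ 0) →
    ∃ λ σ → Holds (run steps s) σᴬ σ × Feasible I σ ×
      (∀ σ* → GoodStart (s Tᴬ 0) (s θᴬ 0) σ₀ σ* → Settled I (s Tᴬ 0) (s θᴬ 0) σ)
  steps-spec 1≤n 1≤m s σ₀ ctx σ≡ feasible zeros =
    let σ , holds , feas , progress = Run.current iterated in
    σ , holds , feas , λ σ* (f , l , large) →
      Relabelling.progress-end I σ* f l (enough-steps 1≤n 1≤m) (progress σ* f l large)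
    where
    record Run (c : ℕ) (s′ : Memory) : Set where
      field
        context : Context I s′
        T≡      : s′ Tᴬ 0 ≡ s Tᴬ 0
        θ≡      : s′ θᴬ 0 ≡ s θᴬ 0
        current : ∃ λ σ → Holds s′ σᴬ σ × Feasible I σ ×
          (∀ σ* (f : Feasible I σ*) (l : ∀ i → load I σ* i ≤ s Tᴬ 0) →
            (∀ j → s θᴬ 0 < p j → σ₀ j ≡ σ* j) →
            Relabelling.Progress I {θ = s θᴬ 0} σ* f l c σ (labels I s′))
    open Run
    one-step : ∀ c s′ → Run c s′ → Run (suc c) (run step s′)
    one-step c s′ w = let σ , σ≡ , feas , progress = current w
                          σ′ , σ′≡ , st = step-spec I s′ σ (context w) σ≡ in record
      { context = context-run I step s′ refl (context w)
      ; T≡ = trans (run-keeps step Tᴬ refl s′ 0) (T≡ w)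
      ; θ≡ = trans (run-keeps step θᴬ refl s′ 0) (θ≡ w)
      ; current = σ′ , σ′≡ , step-feasible I st feas , λ σ* f l large →
          Relabelling.progress-step I σ* f l
            (subst₂ (λ t h → Step I t h σ (labels I s′) σ′ (labels I (run step s′))) (T≡ w) (θ≡ w) st)
            (progress σ* f l large)
      }
    in-A : ∀ {c} s′ k → Run c s′ → Run c (write s′ Aᴬ 0 k)
    in-A s′ k w = record
      { context = context-run I (Aᴬ [ lit 0 ]:= lit k) s′ refl (context w)
      ; T≡ = T≡ w ; θ≡ = θ≡ w ; current = current w }
    in-B : ∀ {c} s′ k → Run c s′ → Run c (write s′ Bᴬ 0 k)
    in-B s′ k w = record
      { context = context-run I (Bᴬ [ lit 0 ]:= lit k) s′ refl (context w)
      ; T≡ = T≡ w ; θ≡ = θ≡ w ; current = current w }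
    in-C : ∀ {c} s′ k → Run c s′ → Run c (write s′ Cᴬ 0 k)
    in-C s′ k w = record
      { context = context-run I (Cᴬ [ lit 0 ]:= lit k) s′ refl (context w)
      ; T≡ = T≡ w ; θ≡ = θ≡ w ; current = current w }
    loop₁ : ∀ c s′ → Run c s′ → Run (m * 1 + c) (run steps₁ s′)
    loop₁ c s′ w = repeat-rule Run Aᴬ machines step 1
      (λ i s″ k w′ → one-step i (write s″ Aᴬ 0 k) (in-A s″ k w′)) c s′ (m≡ (context w)) (in-A s′ m w)
    loop₂ : ∀ c s′ → Run c s′ → Run (m * (m * 1) + c) (run steps₂ s′)
    loop₂ c s′ w = repeat-rule Run Bᴬ machines steps₁ (m * 1)
      (λ i s″ k w′ → loop₁ i (write s″ Bᴬ 0 k) (in-B s″ k w′)) c s′ (m≡ (context w)) (in-B s′ m w)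
    iterated : Run ((n + (n + n)) * (m * (m * 1)) + 0) (run steps s)
    iterated = repeat-rule Run Cᴬ (jobs ∔ (jobs ∔ jobs)) steps₂ (m * (m * 1))
      (λ i s″ k w′ → loop₂ i (write s″ Cᴬ 0 k) (in-C s″ k w′))
      0 s (cong₂ _+_ (n≡ ctx) (cong₂ _+_ (n≡ ctx) (n≡ ctx)))
      (in-C s (n + (n + n)) (record
        { context = ctx ; T≡ = refl ; θ≡ = refl
        ; current = σ₀ , σ≡ , feasible , λ σ* f l large →
            Relabelling.progress-start I σ* f l large zeros }))

module _ {n m : ℕ} (I : Instance n m) where
  open Instance I
  open Context

  copy-spec : ∀ a b → writes (copy a b) b ≡ false → does (a ≟ Jᴬ) ≡ false →
    ∀ s (σ : Assignment n m) → Context I s → Holds s b σ → Holds (run (copy a b) s) a σ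
  copy-spec a b b-kept a≠J s σ ctx σ≡ j =
    for-rule P Jᴬ jobs (copy-entry a b) s (n≡ ctx) body (beyond _) j z≤n
    where
    P : ℕ → Memory → Set
    P k s′ = ∀ j → k ≤ toℕ j → s′ a (toℕ j) ≡ toℕ (σ j)
    body : ∀ (k : Fin n) s′ → Unchanged (copy a b) s s′ → P (suc (toℕ k)) s′ →
      P (toℕ k) (run (copy-entry a b) (write s′ Jᴬ 0 (toℕ k)))
    body k s′ same done = extend _ k
      (trans (write-same s₁ a (toℕ k) (s₁ b (toℕ k)))
        (trans (write-other s′ Jᴬ 0 (toℕ k) b (toℕ k) (∨-falseˡ (does (b ≟ Jᴬ)) b-kept))
          (trans (same b (toℕ k) b-kept) (σ≡ k))))
      λ j k<j → write-case (_≡ toℕ (σ j)) s₁ a (toℕ k) (s₁ b (toℕ k)) (toℕ j)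
        (λ j≡k → contradiction (sym j≡k) (<⇒≢ k<j))
        (λ _ → trans (write-other s′ Jᴬ 0 (toℕ k) a (toℕ j) a≠J) (done j k<j))
      where
      s₁ = write s′ Jᴬ 0 (toℕ k)

  record Ready (τ : Assignment n m) (V : ℕ) (s : Memory) : Set where
    field
      context   : Context I s
      τ≡        : Holds s τᴬ τ
      incumbent : ∃ λ σ → Holds s outᴬ σ × Feasible I σ × Cmax I σ ≡ s bestᴬ 0
      best≤     : s bestᴬ 0 ≤ V

  open Ready

  touchesReady : Cmd → Bool
  touchesReady c = touchesContext c ∨ (writes c τᴬ ∨ (writes c outᴬ ∨ writes c bestᴬ))

  ready-unchanged : ∀ c {τ V s s′} → touchesReady c ≡ false → Unchanged c s s′ →
    Ready τ V s → Ready τ V s′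
  ready-unchanged c {s = s} {s′} eq same rdy = record
    { context = context-unchanged I c (∨-falseˡ (touchesContext c) eq) same (context rdy)
    ; τ≡ = λ j → trans (same τᴬ (toℕ j) (∨-falseˡ (writes c τᴬ) eq₁)) (τ≡ rdy j)
    ; incumbent = let σ , σ≡ , feas , val≡ = incumbent rdy in
        σ , (λ j → trans (same outᴬ (toℕ j) (∨-falseˡ (writes c outᴬ) eq₂)) (σ≡ j)) , feas ,
        trans val≡ (sym best≡)
    ; best≤ = ≤-trans (≤-reflexive best≡) (best≤ rdy)
    }
    where
    eq₁ = ∨-falseʳ (touchesContext c) eq
    eq₂ = ∨-falseʳ (writes c τᴬ) eq₁
    best≡ = same bestᴬ 0 (∨-falseʳ (writes c outᴬ) eq₂)

  ready-run : ∀ c {τ V} s → touchesReady c ≡ false → Ready τ V s → Ready τ V (run c s)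
  ready-run c s eq = ready-unchanged c eq (run-unchanged c s)

  ready-bound : ∀ {τ V W s} → Ready τ V s → s bestᴬ 0 ≤ W → Ready τ W s
  ready-bound rdy ≤W = record
    { context = context rdy ; τ≡ = τ≡ rdy ; incumbent = incumbent rdy ; best≤ = ≤W }

  ready-assign : ∀ {τ τ′ V s k v} j → Ready τ V s → k ≡ toℕ j → v ≡ toℕ (τ′ j) →
    (∀ l → l ≢ j → τ′ l ≡ τ l) → Ready τ′ V (write s τᴬ k v)
  ready-assign {τ} {τ′} {V} {s} {k} {v} j rdy k≡ v≡ same = record
    { context = context-run I (τᴬ [ lit k ]:= lit v) s refl (context rdy)
    ; τ≡ = λ l → write-case (_≡ toℕ (τ′ l)) s τᴬ k v (toℕ l)
        (λ l≡k → trans v≡ (cong (toℕ ∘ τ′) (sym (Fin.toℕ-injective (trans l≡k k≡)))))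
        (λ l≢k → trans (τ≡ rdy l)
          (cong toℕ (sym (same l λ l≡j → l≢k (trans (cong toℕ l≡j) (sym k≡))))))
    ; incumbent = incumbent rdy
    ; best≤ = best≤ rdy
    }

  record-best-spec : ∀ s τ σ → Context I s → Holds s τᴬ τ → Holds s σᴬ σ → Feasible I σ →
    s maxᴬ 0 ≡ Cmax I σ → Ready τ (Cmax I σ) (run record-best s)
  record-best-spec s τ σ ctx τ≡ σ≡ feas max≡ = record
    { context = context-run I record-best s refl ctx
    ; τ≡ = λ j → trans (run-keeps record-best τᴬ refl s (toℕ j)) (τ≡ j)
    ; incumbent = σ , copy-spec outᴬ σᴬ refl refl s₁ σ
        (context-run I (bestᴬ [ lit 0 ]:= val maxᴬ) s refl ctx) σ≡ , feas ,
        trans (sym max≡) (sym best≡)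
    ; best≤ = ≤-reflexive (trans best≡ max≡)
    }
    where
    s₁ = write s bestᴬ 0 (s maxᴬ 0)
    best≡ : run record-best s bestᴬ 0 ≡ s maxᴬ 0
    best≡ = run-keeps (copy outᴬ σᴬ) bestᴬ refl s₁ 0

  improve-spec : ∀ s τ V σ → Ready τ V s → Holds s σᴬ σ → Feasible I σ → s maxᴬ 0 ≡ Cmax I σ →
    Ready τ V (run improve s) × run improve s bestᴬ 0 ≤ Cmax I σ
  improve-spec s τ V σ rdy σ≡ feas max≡ =
    when-rule (λ s′ → Ready τ V s′ × s′ bestᴬ 0 ≤ Cmax I σ) (val bestᴬ ⊖ val maxᴬ) record-best nop s
      (λ ≢0 → let new = record-best-spec s τ σ (context rdy) (τ≡ rdy) σ≡ feas max≡ in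
        ready-bound new (≤-trans (best≤ new) (≤-trans
          (subst (_≤ s bestᴬ 0) max≡ (<⇒≤ (m∸n≢0⇒n<m ≢0))) (best≤ rdy))) ,
        best≤ new)
      (λ ≡0 → rdy , subst (s bestᴬ 0 ≤_) max≡ (m∸n≡0⇒m≤n ≡0))

  Optimal : Assignment n m → Set
  Optimal σ* = Feasible I σ* × Cmax I σ* ≡ OPT I

  attempt-spec : 1 ≤ n → 1 ≤ m → ∀ τ V s → Ready τ V s → s Kᴬ 0 ≤ n →
    let T = s baseᴬ 0 ∸ s Kᴬ 0 * s θᴬ 0 in
    Ready τ V (run attempt s) ×
    (∀ σ* → Feasible I σ* → (∀ i → load I σ* i ≤ T) → (∀ j → s θᴬ 0 < p j → τ j ≡ σ* j) →
      run attempt s bestᴬ 0 ≤ T + s θᴬ 0)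
  attempt-spec 1≤n 1≤m τ V s rdy K≤n = proj₁ improved , λ σ* feas* load* agree →
    ≤-trans (proj₂ improved) (Max≤ (load I σ) λ u → subst₂ (λ t h → load I σ u ≤ t + h) T≡ θ≡
      (settled σ* (feas* , (λ i → subst (load I σ* i ≤_) (sym T≡) (load* i)) , large σ* feas* agree) u))
    where
    s₁ = run start s
    s₂ = run setup s
    s₃ = run steps s₂
    s₄ = run evaluate s₃
    started = start-spec I s τ (context rdy) (τ≡ rdy)
    σ₀ = proj₁ started
    placed = proj₂ (proj₂ started)
    rdy₁ = ready-run start s refl rdy
    rdy₂ = ready-run setup s refl rdy
    T≡ : s₂ Tᴬ 0 ≡ s baseᴬ 0 ∸ s Kᴬ 0 * s θᴬ 0
    T≡ = trans (run-keeps (clear dᴬ) Tᴬ refl (run set-T s₁) 0)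
      (trans (set-T-spec I s₁ (context rdy₁) (subst (_≤ n) (sym K₁) K≤n))
        (cong₂ _∸_ (run-keeps start baseᴬ refl s 0) (cong₂ _*_ K₁ (run-keeps start θᴬ refl s 0))))
      where
      K₁ : s₁ Kᴬ 0 ≡ s Kᴬ 0
      K₁ = run-keeps start Kᴬ refl s 0
    θ≡ : s₂ θᴬ 0 ≡ s θᴬ 0
    θ≡ = run-keeps setup θᴬ refl s 0
    stepped = steps-spec I 1≤n 1≤m s₂ σ₀ (context rdy₂)
      (λ j → trans (run-keeps (set-T ⨟ clear dᴬ) σᴬ refl s₁ (toℕ j)) (proj₁ (proj₂ started) j))
      (λ j → proj₁ (placed j))
      (clear-spec I dᴬ refl (run set-T s₁) (context (ready-run (start ⨟ set-T) s refl rdy)))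
    σ = proj₁ stepped
    settled = proj₂ (proj₂ (proj₂ stepped))
    large : ∀ σ* → Feasible I σ* → (∀ j → s θᴬ 0 < p j → τ j ≡ σ* j) →
      ∀ j → s₂ θᴬ 0 < p j → σ₀ j ≡ σ* j
    large σ* feas* agree j θ<p = let τ≡σ* = agree j (subst (_< p j) θ≡ θ<p) in
      trans (proj₂ (placed j) (subst (_< p j) θ≡ θ<p) (subst (_∈ˢ Γ j) (sym τ≡σ*) (feas* j))) τ≡σ*
    rdy₃ = ready-run steps s₂ refl rdy₂
    improved = improve-spec s₄ τ V σ (ready-run evaluate s₃ refl rdy₃)
      (λ j → trans (run-keeps evaluate σᴬ refl s₃ (toℕ j)) (proj₁ (proj₂ stepped) j))
      (proj₁ (proj₂ (proj₂ stepped)))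
      (evaluate-spec I s₃ σ (context rdy₃) (proj₁ (proj₂ stepped)))

  -- A loop that never worsens the incumbent ends at least as good as any
  -- single one of its iterations.
  best-of-loop : ∀ τ x r c s {N} → eval s ⌜ r ⌝ ≡ N → touchesReady (x [ lit 0 ]:= lit 0) ≡ false →
    (∀ V (k : Fin N) s′ → Unchanged (for x below r repeat c) s s′ → s′ x 0 ≡ toℕ k →
      Ready τ V s′ → Ready τ V (run c s′)) →
    ∀ {V} → Ready τ V s →
    Ready τ V (run (for x below r repeat c) s) ×
    (∀ W (k : Fin N) → (∀ s′ → Unchanged (for x below r repeat c) s s′ → s′ x 0 ≡ toℕ k →
      Ready τ V s′ → run c s′ bestᴬ 0 ≤ W) → run (for x below r repeat c) s bestᴬ 0 ≤ W)
  best-of-loop τ x r c s {N} N≡ untouched body {V} rdy =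
    for-rule (λ _ → Ready τ V) x r c s N≡
      (λ k s′ same rdy′ → body V k _ (moved same) (write-same s′ x 0 (toℕ k)) (written rdy′))
      (written rdy) ,
    λ W k* hit → best≤ (proj₂ (for-rule (P W k*) x r c s N≡
      (λ k s′ same (rdy′ , done) →
        body V k _ (moved same) (write-same s′ x 0 (toℕ k)) (written rdy′) ,
        λ k≤k* → case m≤n⇒m<n∨m≡n k≤k* of λ where
          (inj₁ k<k*) → body W k _ (moved same) (write-same s′ x 0 (toℕ k)) (written (done k<k*))
          (inj₂ k≡k*) → ready-bound
            (body V k _ (moved same) (write-same s′ x 0 (toℕ k)) (written rdy′))
            (hit _ (moved same) (trans (write-same s′ x 0 (toℕ k)) k≡k*) (written rdy′)))
      (written rdy , λ N≤k* → contradiction (Fin.toℕ<n k*) (≤⇒≯ N≤k*))) z≤n)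
    where
    P : ℕ → Fin N → ℕ → Memory → Set
    P W k* k s′ = Ready τ V s′ × (k ≤ toℕ k* → Ready τ W s′)
    written : ∀ {V k s′} → Ready τ V s′ → Ready τ V (write s′ x 0 k)
    written {k = k} {s′} = ready-run (x [ lit 0 ]:= lit k) s′ untouched
    moved : ∀ {k s′} → Unchanged (for x below r repeat c) s s′ →
      Unchanged (for x below r repeat c) s (write s′ x 0 k)
    moved {k} {s′} same b l eq =
      trans (write-other s′ x 0 k b l (∨-falseˡ (does (b ≟ x)) eq)) (same b l eq)

  module Hits (1≤n : 1 ≤ n) (1≤m : 1 ≤ m) where

    Agree : ℕ → Assignment n m → Assignment n m → Set
    Agree θ τ σ* = ∀ j → θ < p j → τ j ≡ σ* j

    threshold-body-spec : ∀ τ V s → Ready τ V s →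
      Ready τ V (run threshold-body s) ×
      (∀ σ* → Optimal σ* → Agree (array p (s Qᴬ 0)) τ σ* →
        run threshold-body s bestᴬ 0 ≤ OPT I + 2 * array p (s Qᴬ 0))
    threshold-body-spec τ V s rdy = proj₁ loop , hits
      where
      θ = array p (s Qᴬ 0)
      s₁ = write s θᴬ 0 (s pᴬ (s Qᴬ 0))
      s₂ = run start s₁
      s₃ = run threshold-setup s
      rdy₁ = ready-run (θᴬ [ lit 0 ]:= pᴬ [ val Qᴬ ]) s refl rdy
      rdy₂ = ready-run start s₁ refl rdy₁
      rdy₃ = ready-run threshold-setup s refl rdy
      started = start-spec I s₁ τ (context rdy₁) (τ≡ rdy₁)
      σ₀ = proj₁ started
      placed = proj₂ (proj₂ started)
      θ≡ : s₃ θᴬ 0 ≡ θ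
      θ≡ = trans (run-keeps (start ⨟ (evaluate ⨟ baseᴬ [ lit 0 ]:= val maxᴬ)) θᴬ refl s₁ 0)
                 (p-array (context rdy) (s Qᴬ 0))
      base≡ : s₃ baseᴬ 0 ≡ Cmax I σ₀
      base≡ = evaluate-spec I s₂ σ₀ (context rdy₂) (proj₁ (proj₂ started))
      loop = best-of-loop τ Kᴬ (one ∔ jobs) attempt s₃ (cong suc (n≡ (context rdy₃))) refl
        (λ V k s′ _ K≡ rdy′ → proj₁ (attempt-spec 1≤n 1≤m τ V s′ rdy′
          (subst (_≤ n) (sym K≡) (s≤s⁻¹ (Fin.toℕ<n k))))) rdy₃
      hits : ∀ σ* → Optimal σ* → Agree θ τ σ* → run threshold-body s bestᴬ 0 ≤ OPT I + 2 * θ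
      hits σ* (feas* , opt*) agree = proj₂ loop (OPT I + 2 * θ) (fromℕ< (s≤s i≤n))
        λ s′ same K≡ rdy′ →
          let K≡i = trans K≡ (Fin.toℕ-fromℕ< (s≤s i≤n))
              θ′ = trans (same θᴬ 0 refl) θ≡
              T≡ = cong₂ _∸_ (trans (same baseᴬ 0 refl) base≡) (cong₂ _*_ K≡i θ′)
          in ≤-trans (proj₂ (attempt-spec 1≤n 1≤m τ V s′ rdy′ (subst (_≤ n) (sym K≡i) i≤n))
                σ* feas*
                (λ u → subst (load I σ* u ≤_) (sym T≡) (≤-trans (load*≤ u) lo))
                (λ j θ<p → agree j (subst (_< p j) θ′ θ<p)))
              (≤-trans (≤-reflexive (cong₂ _+_ T≡ θ′))
                (≤-trans (+-monoˡ-≤ θ hi) (≤-reflexive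
                  (trans (+-assoc (OPT I) θ θ) (cong (OPT I +_) (cong (θ +_) (sym (+-identityʳ θ))))))))
        where
        load*≤ : ∀ u → load I σ* u ≤ OPT I
        load*≤ u = subst (load I σ* u ≤_) opt* (≤Max (load I σ*) u)
        large : ∀ j → θ < p j → σ₀ j ≡ σ* j
        large j θ<p = trans (proj₂ (placed j)
          (subst (_< p j) (sym (p-array (context rdy) (s Qᴬ 0))) θ<p)
          (subst (_∈ˢ Γ j) (sym (agree j θ<p)) (feas* j))) (agree j θ<p)
        index = threshold-index {OPT I} {Cmax I σ₀} {θ} n
          (proj₂ (proj₂ (opt-exists I)) (Cmax I σ₀) (σ₀ , (λ j → proj₁ (placed j)) , refl))
          (Max≤ (load I σ₀) λ u → ≤-trans (start-load I large u) (+-monoˡ-≤ (n * θ) (load*≤ u)))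
        i≤n = proj₁ (proj₂ index)
        lo = proj₁ (proj₂ (proj₂ index))
        hi = proj₂ (proj₂ (proj₂ index))

    thresholds-spec : ∀ τ V s → Ready τ V s →
      Ready τ V (run thresholds s) ×
      (∀ (q : Fin (suc n)) σ* → Optimal σ* → Agree (array p (toℕ q)) τ σ* →
        run thresholds s bestᴬ 0 ≤ OPT I + 2 * array p (toℕ q))
    thresholds-spec τ V s rdy = proj₁ loop , λ q σ* opt agree →
      proj₂ loop (OPT I + 2 * array p (toℕ q)) q λ s′ _ Q≡ rdy′ →
        subst (λ l → run threshold-body s′ bestᴬ 0 ≤ OPT I + 2 * array p l) Q≡
          (proj₂ (threshold-body-spec τ V s′ rdy′) σ* opt
            (subst (λ l → Agree (array p l) τ σ*) (sym Q≡) agree))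
      where
      loop = best-of-loop τ Qᴬ (one ∔ jobs) threshold-body s (cong suc (n≡ (context rdy))) refl
        (λ V k s′ _ _ rdy′ → proj₁ (threshold-body-spec τ V s′ rdy′)) rdy

-- Guessing the moved large jobs

-- Each level of guessing has three names of its own.
offset : ℕ → ℕ
offset zero    = 0
offset (suc K) = 3 + offset K

jobᵍ machineᵍ savedᵍ : ℕ → Name
jobᵍ K     = 30 + offset K
machineᵍ K = 31 + offset K
savedᵍ K   = 32 + offset K

guess guess-body guess-machines : ℕ → Cmd
guess zero    = thresholds
guess (suc K) = for jobᵍ K below jobs repeat guess-machines K
guess-body K  =
  savedᵍ K [ lit 0 ]:= τᴬ [ val (jobᵍ K) ] ⨟
  (τᴬ [ val (jobᵍ K) ]:= val (machineᵍ K) ⨟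
  (guess K ⨟
  τᴬ [ val (jobᵍ K) ]:= val (savedᵍ K)))
guess-machines K = for machineᵍ K below machines repeat guess-body K

initialise : Cmd
initialise = rows ⨟ (copy τᴬ πᴬ ⨟ (start ⨟ (evaluate ⨟ record-best)))

main : ℕ → Cmd
main K = when val nᴬ then initialise ⨟ guess K otherwise nop

guess-fresh : ∀ K o → offset K ≤ o → writes (guess K) (30 + o) ≡ false
guess-fresh zero    o _  = refl
guess-fresh (suc K) o K≤ = ∨-join (distinct (offset K) (≤-trans (m≤n+m _ 2) K≤))
  (∨-join (distinct (suc (offset K)) (≤-trans (n≤1+n _) K≤))
  (∨-join (distinct (2 + offset K) K≤)
  (∨-join (guess-fresh K o (≤-trans (m≤n+m (offset K) 3) K≤)) refl)))
  where
  distinct : ∀ x → suc x ≤ o → does (o ≟ x) ≡ false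
  distinct x x<o = dec-false (o ≟ x) (<⇒≢ x<o ∘ sym)

guess-wellFormed : ∀ K → wellFormed (guess K) ≡ true
guess-wellFormed zero    = refl
guess-wellFormed (suc K) = ∧-join
  (cong not (∨-join (distinct 0) (∨-join (distinct 1)
    (∨-join (guess-fresh K (offset K) ≤-refl) refl))))
  (∧-join
    (cong not (∨-join (distinct 0) (∨-join (guess-fresh K (suc (offset K)) (n≤1+n _)) refl)))
    (∧-join (guess-wellFormed K) refl))
  where
  distinct : ∀ i → does (offset K ≟ suc i + offset K) ≡ false
  distinct i = dec-false (offset K ≟ suc i + offset K) (<⇒≢ (s≤s (m≤n+m (offset K) i)))

main-wellFormed : ∀ K → wellFormed (main K) ≡ true
main-wellFormed K = ∧-join (guess-wellFormed K) refl

module _ {n m : ℕ} (I : Instance n m) where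
  open Instance I
  open Context
  open Ready

  initialise-spec : ∀ π̂ → ∃ λ V → Ready I π̂ V (run initialise (input I π̂))
  initialise-spec π̂ = Cmax I σ₀ , record-best-spec I s₃ π̂ σ₀ ctx₃
      (λ j → trans (run-keeps (start ⨟ evaluate) τᴬ refl s₁ (toℕ j)) (τ₁ j))
      (λ j → trans (run-keeps evaluate σᴬ refl s₂ (toℕ j)) (proj₁ (proj₂ started) j))
      (λ j → proj₁ (proj₂ (proj₂ started) j))
      (evaluate-spec I s₂ σ₀ ctx₂ (proj₁ (proj₂ started)))
    where
    s₀ = run rows (input I π̂)
    s₁ = run (copy τᴬ πᴬ) s₀
    s₂ = run start s₁
    s₃ = run evaluate s₂
    ctx₀ = initial-context I π̂
    ctx₁ = context-run I (copy τᴬ πᴬ) s₀ refl ctx₀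
    ctx₂ = context-run I start s₁ refl ctx₁
    ctx₃ = context-run I evaluate s₂ refl ctx₂
    τ₁ : Holds s₁ τᴬ π̂
    τ₁ = copy-spec I τᴬ πᴬ refl refl s₀ π̂ ctx₀ λ j →
      trans (run-keeps rows πᴬ refl (input I π̂) (toℕ j)) (array-at (toℕ ∘ π̂) j)
    started = start-spec I s₁ π̂ ctx₁ τ₁
    σ₀ = proj₁ started

  module _ (1≤n : 1 ≤ n) (1≤m : 1 ≤ m) where
    open Hits I 1≤n 1≤m

    GuessKeeps : ℕ → Set
    GuessKeeps K = ∀ τ V s → Ready I τ V s → Ready I τ V (run (guess K) s)

    module GuessBody (K : ℕ) (keeps : GuessKeeps K) (τ : Assignment n m) (s : Memory)
                     (j : Fin n) (i : Fin m)
                     (j≡ : s (jobᵍ K) 0 ≡ toℕ j) (i≡ : s (machineᵍ K) 0 ≡ toℕ i) where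
      s₁ s₂ s₃ : Memory
      s₁ = write s (savedᵍ K) 0 (s τᴬ (s (jobᵍ K) 0))
      s₂ = write s₁ τᴬ (s₁ (jobᵍ K) 0) (s₁ (machineᵍ K) 0)
      s₃ = run (guess K) s₂

      τ′ : Assignment n m
      τ′ = updateAt τ j (const i)

      job₁ : s₁ (jobᵍ K) 0 ≡ toℕ j
      job₁ = trans (write-other s (savedᵍ K) 0 _ (jobᵍ K) 0
        (dec-false (offset K ≟ 2 + offset K) (<⇒≢ (s≤s (n≤1+n _))))) j≡

      machine₁ : s₁ (machineᵍ K) 0 ≡ toℕ i
      machine₁ = trans (write-other s (savedᵍ K) 0 _ (machineᵍ K) 0
        (dec-false (offset K ≟ 1 + offset K) (<⇒≢ ≤-refl))) i≡

      ready₂ : ∀ {V} → Ready I τ V s → Ready I τ′ V s₂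
      ready₂ rdy = ready-assign I j
        (ready-run I (savedᵍ K [ lit 0 ]:= τᴬ [ val (jobᵍ K) ]) s refl rdy)
        job₁ (trans machine₁ (cong toℕ (sym (updateAt-updates j τ))))
        (λ l l≢j → updateAt-minimal l j τ l≢j)

      ready₃ : ∀ {V} → Ready I τ V s → Ready I τ′ V s₃
      ready₃ {V} rdy = keeps τ′ V s₂ (ready₂ rdy)

      ready-end : ∀ {V} → Ready I τ V s → Ready I τ V (run (guess-body K) s)
      ready-end rdy = ready-assign I j (ready₃ rdy)
        (trans (run-keeps (guess K) (jobᵍ K) (guess-fresh K (offset K) ≤-refl) s₂ 0) job₁)
        (trans (run-keeps (guess K) (savedᵍ K) (guess-fresh K (2 + offset K) (m≤n+m _ 2)) s₂ 0)
          (trans (write-same s (savedᵍ K) 0 _) (trans (cong (s τᴬ) j≡) (τ≡ rdy j))))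
        (λ l l≢j → sym (updateAt-minimal l j τ l≢j))

    module GuessMachines (K : ℕ) (keeps : GuessKeeps K) (τ : Assignment n m) (V : ℕ) (s : Memory)
                         (j : Fin n)
                         (j≡ : s (jobᵍ K) 0 ≡ toℕ j) (rdy : Ready I τ V s) where
      job-kept : writes (guess-machines K) (jobᵍ K) ≡ false
      job-kept = not-true _
        (∧-splitˡ (not (writes (guess-machines K) (jobᵍ K))) (guess-wellFormed (suc K)))

      loop = best-of-loop I τ (machineᵍ K) machines (guess-body K) s (m≡ (context rdy)) refl
        (λ V i s′ same i≡ rdy′ → GuessBody.ready-end K keeps τ s′ j i
          (trans (same (jobᵍ K) 0 job-kept) j≡) i≡ rdy′) rdy

      hit : ∀ W i → (∀ s′ → Ready I (updateAt τ j (const i)) V s′ → run (guess K) s′ bestᴬ 0 ≤ W) →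
        run (guess-machines K) s bestᴬ 0 ≤ W
      hit W i good = proj₂ loop W i λ s′ same i≡ rdy′ →
        good _ (GuessBody.ready₂ K keeps τ s′ j i (trans (same (jobᵍ K) 0 job-kept) j≡) i≡ rdy′)

    guess-loop : ∀ K → GuessKeeps K → ∀ τ V s → Ready I τ V s → _
    guess-loop K keeps τ V s rdy = best-of-loop I τ (jobᵍ K) jobs (guess-machines K) s
      (n≡ (context rdy)) refl
      (λ V j s′ _ j≡ rdy′ → proj₁ (GuessMachines.loop K keeps τ V s′ j j≡ rdy′)) {V} rdy

    guess-keeps : ∀ K → GuessKeeps K
    guess-keeps zero    τ V s rdy = proj₁ (thresholds-spec τ V s rdy)
    guess-keeps (suc K) τ V s rdy = proj₁ (guess-loop K (guess-keeps K) τ V s rdy)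

    module _ (σ* : Assignment n m) (optimal : Optimal I σ*) (q : Fin (suc n)) where
      private
        θ = array p (toℕ q)

      mismatch : Assignment n m → Fin n → ℕ
      mismatch τ j = if does (θ <? p j) then (if does (τ j Fin.≟ σ* j) then 0 else 1) else 0

      mismatch-agree : ∀ τ {j} → τ j ≡ σ* j → mismatch τ j ≡ 0
      mismatch-agree τ {j} eq rewrite dec-true (τ j Fin.≟ σ* j) eq with does (θ <? p j)
      ... | true  = refl
      ... | false = refl

      mismatch-1 : ∀ τ {j} → θ < p j → τ j ≢ σ* j → mismatch τ j ≡ 1
      mismatch-1 τ {j} θ<p ≢
        rewrite dec-true (θ <? p j) θ<p | dec-false (τ j Fin.≟ σ* j) ≢ = refl

      mismatch-small : ∀ τ {j} → ¬ θ < p j → mismatch τ j ≡ 0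
      mismatch-small τ {j} θ≮p rewrite dec-false (θ <? p j) θ≮p = refl

      mismatch-cong : ∀ {τ τ′ j} → τ j ≡ τ′ j → mismatch τ j ≡ mismatch τ′ j
      mismatch-cong {τ} {τ′} {j} eq =
        cong (λ i → if does (θ <? p j) then (if does (i Fin.≟ σ* j) then 0 else 1) else 0) eq

      agreement : ∀ τ → Σℕ (mismatch τ) ≤ 0 → Agree θ τ σ*
      agreement τ none j θ<p = decidable-stable (τ j Fin.≟ σ* j) λ ≢ →
        n≮0 (≤-trans (≤-reflexive (sym (mismatch-1 τ θ<p ≢))) (≤-trans (≤Σ (mismatch τ) j) none))

      correct≤ : ∀ τ j k → mismatch (updateAt τ j (const (σ* j))) k ≤ mismatch τ k
      correct≤ τ j k with k Fin.≟ j
      ... | yes refl = ≤-trans (≤-reflexive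
        (mismatch-agree (updateAt τ j (const (σ* j))) (updateAt-updates j τ))) z≤n
      ... | no k≢j   = ≤-reflexive (mismatch-cong {updateAt τ j (const (σ* j))} {τ}
                                     (updateAt-minimal k j τ k≢j))

      improve-guess : ∀ K τ → Σℕ (mismatch τ) ≤ suc K →
        ∃ λ j → Σℕ (mismatch (updateAt τ j (const (σ* j)))) ≤ K
      improve-guess K τ few with Fin.any? (λ j → mismatch τ j ≟ 1)
      ... | yes (j , wrong) = j , s≤s⁻¹ (≤-trans (Σ-mono-< (correct≤ τ j) j
        (≤-trans (≤-reflexive (cong suc (mismatch-agree (updateAt τ j (const (σ* j))) (updateAt-updates j τ))))
          (≤-reflexive (sym wrong)))) few)
      ... | no ¬wrong = first , ≤-trans (Σ-mono (correct≤ τ first))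
        (≤-trans (≤-trans (Σ-mono right) (≤-reflexive (trans (Σ-const n 0) (*-zeroʳ n)))) z≤n)
        where
        first : Fin n
        first = fromℕ< 1≤n
        right : ∀ j → mismatch τ j ≤ 0
        right j = case θ <? p j of λ where
          (no θ≮p)  → ≤-reflexive (mismatch-small τ θ≮p)
          (yes θ<p) → case τ j Fin.≟ σ* j of λ where
            (yes eq) → ≤-reflexive (mismatch-agree τ eq)
            (no ≢)   → contradiction (j , mismatch-1 τ θ<p ≢) ¬wrong

      guess-hits : ∀ K τ V s → Ready I τ V s → Σℕ (mismatch τ) ≤ K →
        run (guess K) s bestᴬ 0 ≤ OPT I + 2 * θ
      guess-hits zero τ V s rdy none =
        proj₂ (thresholds-spec τ V s rdy) q σ* optimal (agreement τ none)
      guess-hits (suc K) τ V s rdy few = let j , fewer = improve-guess K τ few in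
        proj₂ (guess-loop K (guess-keeps K) τ V s rdy) (OPT I + 2 * θ) j λ s′ _ j≡ rdy′ →
          GuessMachines.hit K (guess-keeps K) τ V s′ j j≡ rdy′ (OPT I + 2 * θ) (σ* j)
            λ s″ rdy″ → guess-hits K _ V s″ rdy″ fewer

-- Rational approximation of δ

frac : ℕ → ℕ → ℚ
frac a b = ℤ.+ a ℚ./ suc b

toℚᵘ-frac : ∀ a b → toℚᵘ (frac a b) ≃ᵘ mkℚᵘ (ℤ.+ a) b
toℚᵘ-frac a b = ℚ.toℚᵘ-fromℚᵘ (mkℚᵘ (ℤ.+ a) b)

frac-≤ : ∀ {a b c d} → a * suc d ≤ c * suc b → frac a b ℚ.≤ frac c d
frac-≤ {a} {b} {c} {d} le = ℚ.toℚᵘ-cancel-≤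
  (ℚᵘ.≤-respˡ-≃ (ℚᵘ.≃-sym (toℚᵘ-frac a b)) (ℚᵘ.≤-respʳ-≃ (ℚᵘ.≃-sym (toℚᵘ-frac c d))
    (*≤* (subst₂ ℤ._≤_ (ℤ.pos-* a (suc d)) (ℤ.pos-* c (suc b)) (ℤ.+≤+ le)))))

frac-< : ∀ {a b c d} → a * suc d < c * suc b → frac a b ℚ.< frac c d
frac-< {a} {b} {c} {d} lt = ℚ.toℚᵘ-cancel-<
  (ℚᵘ.<-respˡ-≃ (ℚᵘ.≃-sym (toℚᵘ-frac a b)) (ℚᵘ.<-respʳ-≃ (ℚᵘ.≃-sym (toℚᵘ-frac c d))
    (*<* (subst₂ ℤ._<_ (ℤ.pos-* a (suc d)) (ℤ.pos-* c (suc b)) (ℤ.+<+ lt)))))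

frac-* : ∀ a b c d → frac a b ℚ.* frac c d ≡ frac (a * c) (d + b * suc d)
frac-* a b c d = ℚ.toℚᵘ-injective (ℚᵘ.≃-trans (ℚ.toℚᵘ-homo-* (frac a b) (frac c d))
  (ℚᵘ.≃-trans (ℚᵘ.*-cong (toℚᵘ-frac a b) (toℚᵘ-frac c d))
  (ℚᵘ.≃-trans (ℚᵘ.≃-reflexive (cong (λ i → mkℚᵘ i (d + b * suc d)) (sym (ℤ.pos-* a c))))
    (ℚᵘ.≃-sym (toℚᵘ-frac (a * c) (d + b * suc d))))))

frac-+ : ∀ a b c d → frac a b ℚ.+ frac c d ≡ frac (a * suc d + c * suc b) (d + b * suc d)
frac-+ a b c d = ℚ.toℚᵘ-injective (ℚᵘ.≃-trans (ℚ.toℚᵘ-homo-+ (frac a b) (frac c d))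
  (ℚᵘ.≃-trans (ℚᵘ.+-cong (toℚᵘ-frac a b) (toℚᵘ-frac c d))
  (ℚᵘ.≃-trans (ℚᵘ.≃-reflexive (cong (λ i → mkℚᵘ i (d + b * suc d)) numerator))
    (ℚᵘ.≃-sym (toℚᵘ-frac (a * suc d + c * suc b) (d + b * suc d))))))
  where
  numerator : ℤ.+ a ℤ.* ℤ.+ suc d ℤ.+ ℤ.+ c ℤ.* ℤ.+ suc b ≡ ℤ.+ (a * suc d + c * suc b)
  numerator = sym (trans (ℤ.pos-+ (a * suc d) (c * suc b)) (cong₂ ℤ._+_ (ℤ.pos-* a (suc d)) (ℤ.pos-* c (suc b))))

fromℕ-nonNeg : ∀ e → ℚ.NonNegative (fromℕ e)
fromℕ-nonNeg e = ℚ.normalize-nonNeg e 1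

module _ (δ : ℝ) where
  open ℝ δ

  lower-closed : ∀ {q r} → q ℚ.< r → lower r → lower q
  lower-closed {q} {r} q<r lr = Equivalence.from (lower-rounded q) (r , q<r , lr)

  lower<upper : ∀ {q r} → lower q → upper r → q ℚ.< r
  lower<upper {q} {r} lq ur with ℚ.<-cmp q r
  ... | tri< q<r _ _ = q<r
  ... | tri≈ _ refl _ = contradiction (lq , ur) (disjoint q)
  ... | tri> _ _ r<q =
    contradiction (lq , Equivalence.from (upper-rounded q) (r , r<q , ur)) (disjoint q)

  frac-below : ∀ r → ℚ.Positive r → ∃ λ k → frac 2 (suc k) ℚ.< r
  frac-below r@(mkℚ ℤ.+[1+ a ] d c) _ = d + suc (d + 0) ,
    subst (frac 2 (2 * suc d) ℚ.<_) (ℚ.↥p/↧p≡p r)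
      (frac-< {2} {2 * suc d} {suc a} {d} (m≤m+n (suc (2 * suc d)) (a * suc (2 * suc d))))

  Precision : ℕ → Set
  Precision k = lower (frac 2 k) ×
    ∃ λ a → ∃ λ b → (∀ q → lower q → q ℚ.≤ frac a b) × suc k * a ≤ 6 * suc b

  -- Locatedness only separates δ from two different rationals, so the smallest
  -- k with 2 / k < δ is found up to one unit.
  refine : ¬ lower 1ℚ → ∀ k → lower (frac 2 (suc k)) → ∃ Precision
  refine δ≤1 = go
    where
    below-1 : ∀ q → lower q → q ℚ.≤ frac 1 0
    below-1 q lq = ℚ.≮⇒≥ λ 1<q → δ≤1 (lower-closed 1<q lq)
    go : ∀ k → lower (frac 2 (suc k)) → ∃ Precision
    go zero    l = 1 , l , 1 , 0 , below-1 , s≤s (s≤s z≤n)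
    go (suc k) l with located (frac 2 (suc k)) (frac 2 k)
      (frac-< {2} {suc k} {2} {k} (*-monoʳ-< 2 {suc k} {suc (suc k)} ≤-refl))
    ... | inj₁ l′ = go k l′
    ... | inj₂ u  = suc (suc k) , l , 2 , k , (λ q lq → ℚ.<⇒≤ (lower<upper lq u)) ,
      ≤-trans (m≤m+n ((3 + k) * 2) (k * 4)) (≤-reflexive
        (solve 1 (λ k → (con 3 :+ k) :* con 2 :+ k :* con 4 := con 6 :* (con 1 :+ k)) refl k))

  precision : Unit δ → ∃ Precision
  precision (0<δ , δ≤1) with Equivalence.to (lower-rounded 0ℚ) 0<δ
  ... | r , 0<r , lr with frac-below r (ℚ.positive 0<r)
  ... | k , 2/k<r = refine δ≤1 k (lower-closed 2/k<r lr)

  scaled : ∀ {k a b e} D → (∀ q → lower q → q ℚ.≤ frac a b) → suc k * a ≤ 6 * suc b →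
    e ≤ suc k * D → Scaled≤ e δ (6 * D)
  scaled {k} {a} {b} {e} D δ≤ ka≤ e≤ q lq = ℚ.≤-trans
    (ℚ.*-monoˡ-≤-nonNeg (fromℕ e) {{fromℕ-nonNeg e}} (δ≤ q lq))
    (ℚ.≤-trans (ℚ.≤-reflexive (frac-* e 0 a b)) (frac-≤ {e * a} {b + 0} {6 * D} {0} (begin
      e * a * 1             ≤⟨ *-monoˡ-≤ 1 (*-monoˡ-≤ a e≤) ⟩
      suc k * D * a * 1     ≡⟨ solve 3 (λ k D a → k :* D :* a :* con 1 := D :* (k :* a)) refl (suc k) D a ⟩
      D * (suc k * a)       ≤⟨ *-monoʳ-≤ D ka≤ ⟩
      D * (6 * suc b)       ≡⟨ solve 2 (λ b D → D :* (con 6 :* (con 1 :+ b)) :=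
                                 con 6 :* D :* (con 1 :+ (b :+ con 0))) refl b D ⟩
      6 * D * suc (b + 0)   ∎)))
    where open ≤-Reasoning

  affine : ∀ {k} c O E → lower (frac 2 k) → suc k * c ≤ suc k * O + 2 * E → ≤Affine c O δ E
  affine {k} c O E l le q uq = ℚ.≤-trans
    (ℚ.≤-trans
      (frac-≤ {c} {0} {O * suc d + 2 * E * 1} {d + 0} (begin
        c * suc (d + 0)                    ≡⟨ solve 2 (λ c k → c :* (con 1 :+ (k :* con 1 :+ con 0)) :=
                                                (con 1 :+ k) :* c) refl c k ⟩
        suc k * c                          ≤⟨ le ⟩
        suc k * O + 2 * E                  ≡⟨ solve 3 (λ k O E → (con 1 :+ k) :* O :+ con 2 :* E :=
                                                (O :* (con 1 :+ k :* con 1) :+ con 2 :* E :* con 1) :* con 1)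
                                                refl k O E ⟩
        (O * suc d + 2 * E * 1) * 1        ∎))
      (ℚ.≤-reflexive (sym (trans (cong (fromℕ O ℚ.+_) (frac-* 2 k E 0)) (frac-+ O 0 (2 * E) d)))))
    (ℚ.+-monoʳ-≤ (fromℕ O)
      (ℚ.*-monoʳ-≤-nonNeg (fromℕ E) {{fromℕ-nonNeg E}} (ℚ.<⇒≤ (lower<upper l uq))))
    where
    open ≤-Reasoning
    d = k * 1

array-end : ∀ {k} (f : Fin k → ℕ) → array f k ≡ 0
array-end {k} f with k <? k
... | yes k<k = contradiction k<k (<-irrefl refl)
... | no  _   = refl

largest : ∀ {n} (f : Fin n → ℕ) (b : ℕ → Set) → (∀ x → Dec (b x)) →
  (∃ λ j → b (f j) × ∀ i → b (f i) → f i ≤ f j) ⊎ (∀ i → ¬ b (f i))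
largest {zero}  f b b? = inj₂ λ ()
largest {suc n} f b b? with b? (f zero) | largest (f ∘ suc) b b?
... | no ¬b | inj₂ none = inj₂ λ { zero → ¬b ; (suc i) → none i }
... | no ¬b | inj₁ (j , bj , top) =
  inj₁ (suc j , bj , λ { zero b₀ → contradiction b₀ ¬b ; (suc i) → top i })
... | yes b₀ | inj₂ none =
  inj₁ (zero , b₀ , λ { zero _ → ≤-refl ; (suc i) bi → contradiction bi (none i) })
... | yes b₀ | inj₁ (j , bj , top) with f (suc j) ≤? f zero
...   | yes ≤₀ = inj₁ (zero , b₀ , λ { zero _ → ≤-refl ; (suc i) bi → ≤-trans (top i bi) ≤₀ })
...   | no ≰₀  = inj₁ (suc j , bj , λ { zero _ → ≰⇒≥ ≰₀ ; (suc i) → top i })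

guess-degree : ∀ K → degree (guess (suc K)) ≡ 58 + degree (guess K)
guess-degree K = cong (53 +_) (+-comm (degree (guess K)) 5)

linear-growth : ∀ (f : ℕ → ℕ) c → (∀ K → f (suc K) ≡ c + f K) → ∀ K → f K ≡ f 0 + K * c
linear-growth f c step zero    = sym (+-identityʳ (f 0))
linear-growth f c step (suc K) = begin
  f (suc K)            ≡⟨ step K ⟩
  c + f K              ≡⟨ cong (c +_) (linear-growth f c step K) ⟩
  c + (f 0 + K * c)    ≡⟨ solve 3 (λ c a b → c :+ (a :+ b) := a :+ (c :+ b)) refl c (f 0) (K * c) ⟩
  f 0 + (c + K * c)    ∎
  where
  open ≡-Reasoning

-- The command c stays a variable: degree initialise is a large unary number.
then-guess-degree : ∀ c K → let d = λ K → degree (when val nᴬ then c ⨟ guess K otherwise nop) in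
  d K ≡ d 0 + K * 58
then-guess-degree c = linear-growth (λ K → degree (when val nᴬ then c ⨟ guess K otherwise nop)) 58 λ K → begin
  5 + (degree c + degree (guess (suc K)) + 0)
    ≡⟨ cong (λ g → 5 + (degree c + g + 0)) (guess-degree K) ⟩
  5 + (degree c + (58 + degree (guess K)) + 0)
    ≡⟨ solve 2 (λ a g → con 5 :+ (a :+ (con 58 :+ g) :+ con 0) :=
         con 58 :+ (con 5 :+ (a :+ g :+ con 0))) refl (degree c) (degree (guess K)) ⟩
  58 + (5 + (degree c + degree (guess K) + 0)) ∎
  where
  open ≡-Reasoning

main-degree : ∀ k → degree (main (suc k)) ≤ suc k * (degree (main 0) + 58)
main-degree k = begin
  degree (main (suc k))                    ≡⟨ then-guess-degree initialise (suc k) ⟩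
  degree (main 0) + suc k * 58             ≤⟨ linear k (degree (main 0)) ⟩
  suc k * (degree (main 0) + 58)           ∎
  where
  open ≤-Reasoning
  linear : ∀ k a → a + suc k * 58 ≤ suc k * (a + 58)
  linear k a = ≤-trans (+-monoˡ-≤ (suc k * 58) (m≤m+n a (k * a)))
    (≤-reflexive (sym (*-distribˡ-+ (suc k) a 58)))

when-taken : ∀ e c d s {k} → eval s e ≡ suc k → run (when e then c otherwise d) s ≡ run c s
when-taken e c d s eq = cong (λ k → branch k (run c s) (run d s)) eq

when-degree : ∀ c → 4 ≤ degree (when val nᴬ then c otherwise nop)
when-degree c = m≤m+n 4 (degree c + 0)

Solution : ∀ {n m} → ℕ → Cmd → Instance n m → Assignment n m → Set
Solution {n} {m} k c I π̂ =
  ∃ λ t → ∃ λ s → ∃ λ σ → (compile c , input I π̂ ⇓[ t ] s) × (t ≤ (2 ⊔ n * m) ^ degree c) ×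
    Outputs s σ × Feasible I σ × k * Cmax I σ ≤ k * OPT I + 2 * PredictionError I π̂

module _ {n m : ℕ} (I : Instance n m) where
  open Instance I

  -- The largest processing time of a small job, or the padding 0 of the array
  -- p at index n if there is none.
  small-threshold : ∀ K E → ∃ λ (q : Fin (suc n)) →
    K * array p (toℕ q) ≤ E × (∀ j → array p (toℕ q) < p j → E < K * p j)
  small-threshold K E with largest p (λ x → K * x ≤ E) (λ x → K * x ≤? E)
  ... | inj₁ (j , small , top) = inject₁ j ,
    subst (λ x → K * x ≤ E) (sym θ≡) small ,
    λ i θ<p → ≰⇒> λ small-i → <⇒≱ θ<p (subst (p i ≤_) (sym θ≡) (top i small-i))
    where
    θ≡ : array p (toℕ (inject₁ j)) ≡ p j
    θ≡ = trans (cong (array p) (Fin.toℕ-inject₁ j)) (array-at p j)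
  ... | inj₂ none = Fin.fromℕ n ,
    subst (λ x → K * x ≤ E) (sym θ≡) (≤-trans (≤-reflexive (*-zeroʳ K)) z≤n) ,
    λ i _ → ≰⇒> (none i)
    where
    θ≡ : array p (toℕ (Fin.fromℕ n)) ≡ 0
    θ≡ = trans (cong (array p) (Fin.toℕ-fromℕ n)) (array-end p)

  module _ (1≤n : 1 ≤ n) (1≤m : 1 ≤ m) (π̂ : Assignment n m) where

    few-mismatches : ∀ K E σ* (opt : Optimal I σ*) (q : Fin (suc n)) → move I σ* π̂ ≡ E →
      (∀ j → array p (toℕ q) < p j → E < K * p j) →
      Σℕ (mismatch I 1≤n 1≤m σ* opt q π̂) ≤ K
    few-mismatches K E σ* opt q move≡ large = *-cancelʳ-≤ (Σℕ w) K (suc E) (begin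
      Σℕ w * suc E                    ≡⟨ *-comm (Σℕ w) (suc E) ⟩
      suc E * Σℕ w                    ≡⟨ Σ-* (suc E) w ⟨
      Σℕ (λ j → suc E * w j)          ≤⟨ Σ-mono each ⟩
      Σℕ (λ j → K * (if does (σ* j Fin.≟ π̂ j) then 0 else p j))
                                      ≡⟨ Σ-* K (λ j → if does (σ* j Fin.≟ π̂ j) then 0 else p j) ⟩
      K * move I σ* π̂                 ≡⟨ cong (K *_) move≡ ⟩
      K * E                           ≤⟨ *-monoʳ-≤ K (n≤1+n E) ⟩
      K * suc E                       ∎)
      where
      open ≤-Reasoning
      w = mismatch I 1≤n 1≤m σ* opt q π̂
      zero-at : ∀ j {x} → w j ≡ 0 → suc E * w j ≤ x
      zero-at j w≡0 = ≤-trans (≤-reflexive (trans (cong (suc E *_) w≡0) (*-zeroʳ E))) z≤n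
      each : ∀ j → suc E * w j ≤ K * (if does (σ* j Fin.≟ π̂ j) then 0 else p j)
      each j = case array p (toℕ q) <? p j of λ where
        (no θ≮p)  → zero-at j (mismatch-small I 1≤n 1≤m σ* opt q π̂ θ≮p)
        (yes θ<p) → case π̂ j Fin.≟ σ* j of λ where
          (yes eq) → zero-at j (mismatch-agree I 1≤n 1≤m σ* opt q π̂ eq)
          (no ≢)   → begin
            suc E * w j  ≡⟨ cong (suc E *_) (mismatch-1 I 1≤n 1≤m σ* opt q π̂ θ<p ≢) ⟩
            suc E * 1    ≡⟨ *-identityʳ (suc E) ⟩
            suc E        ≤⟨ large j θ<p ⟩
            K * p j      ≡⟨ cong (λ b → K * (if b then 0 else p j)) (dec-false (σ* j Fin.≟ π̂ j) (≢ ∘ sym)) ⟨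
            K * (if does (σ* j Fin.≟ π̂ j) then 0 else p j) ∎

    result : ℕ → Memory
    result K = run (initialise ⨟ guess K) (input I π̂)

    main-spec : ∀ K → ∃ λ σ → Outputs (result K) σ × Feasible I σ ×
      K * Cmax I σ ≤ K * OPT I + 2 * PredictionError I π̂
    main-spec K =
      let V , ready = initialise-spec I π̂
          σ , outputs , feasible , best≡ = Ready.incumbent
            (guess-keeps I 1≤n 1≤m K π̂ V (run initialise (input I π̂)) ready)
          (σ* , opt , move≡) , _ = proj₂ (error-exists I π̂)
          E = PredictionError I π̂
          q , Kθ≤E , large = small-threshold K E
          θ = array p (toℕ q)
          hit = guess-hits I 1≤n 1≤m σ* opt q K π̂ V (run initialise (input I π̂)) ready
                  (few-mismatches K E σ* opt q move≡ large)
      in σ , outputs , feasible , (begin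
        K * Cmax I σ                 ≤⟨ *-monoʳ-≤ K (≤-trans (≤-reflexive best≡) hit) ⟩
        K * (OPT I + 2 * θ)          ≡⟨ solve 3 (λ K O t → K :* (O :+ con 2 :* t) :=
                                          K :* O :+ con 2 :* (K :* t)) refl K (OPT I) θ ⟩
        K * OPT I + 2 * (K * θ)      ≤⟨ +-monoʳ-≤ (K * OPT I) (*-monoʳ-≤ 2 Kθ≤E) ⟩
        K * OPT I + 2 * E            ∎)
      where
      open ≤-Reasoning

    main-halts : ∀ K → ∃ λ t → (compile (main K) , input I π̂ ⇓[ t ] result K) ×
      t ≤ (2 ⊔ n * m) ^ degree (main K)
    main-halts K = subst (λ s → Halts (compile (main K)) (input I π̂) s (N ^ degree (main K)))
      (when-taken (val nᴬ) (initialise ⨟ guess K) nop (input I π̂) n≡suc)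
      (halts n≤N m≤N (main K) (main-wellFormed K) (input I π̂)
        (array-at {1} (λ _ → n) zero) (array-at {1} (λ _ → m) zero))
      where
      N = 2 ⊔ n * m
      open Timing (m≤m⊔n 2 (n * m))
      n≤N : n ≤ N
      n≤N = ≤-trans (≤-trans (≤-reflexive (sym (*-identityʳ n))) (*-monoʳ-≤ n 1≤m)) (m≤n⊔m 2 (n * m))
      m≤N : m ≤ N
      m≤N = ≤-trans (≤-trans (≤-reflexive (sym (*-identityˡ m))) (*-monoˡ-≤ m 1≤n)) (m≤n⊔m 2 (n * m))
      n≡suc : input I π̂ nᴬ 0 ≡ suc (pred n)
      n≡suc = trans (array-at {1} (λ _ → n) zero) (sym (suc-pred n {{>-nonZero 1≤n}}))

    solved-with-jobs : ∀ k → Solution k (main k) I π̂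
    solved-with-jobs k =
      let σ , outputs , feasible , close = main-spec k
          t , run⇓ , t≤ = main-halts k
      in t , result k , σ , run⇓ , t≤ , outputs , feasible , close

assemble : ∀ D (c : ℕ → Cmd) → (∀ k → degree (c (suc k)) ≤ suc k * D) →
  (∀ k {n m} (I : Instance n m) (π̂ : Assignment n m) → Solution k (c k) I π̂) →
  ∀ (δ : ℝ) → Unit δ →
  ∃ λ (e : ℕ) → Scaled≤ e δ (6 * D) ×
  ∃ λ (A : Program) →
  ∀ {n m : ℕ} (I : Instance n m) (π̂ : Assignment n m) →
  ∃ λ (t : ℕ) → ∃ λ (s : Memory) → ∃ λ (σ : Assignment n m) →
    (A , input I π̂ ⇓[ t ] s) ×
    (t ≤ (2 ⊔ n * m) ^ e) ×
    Outputs s σ ×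
    Feasible I σ ×
    ≤Affine (Cmax I σ) (OPT I) δ (PredictionError I π̂)
assemble D c degree≤ solves δ δ∈ =
  let k , near , a , b , above , ka≤ = precision δ δ∈ in
  degree (c (suc k)) , scaled δ {k} {a} {b} {degree (c (suc k))} D above ka≤ (degree≤ k) ,
  compile (c (suc k)) , λ I π̂ →
  let t , s , σ , run⇓ , t≤ , outputs , feasible , close = solves (suc k) I π̂ in
  t , s , σ , run⇓ , t≤ , outputs , feasible ,
  affine δ {k} (Cmax I σ) (OPT I) (PredictionError I π̂) near close

solved-without-jobs : ∀ k c {m} (I : Instance 0 m) (π̂ : Assignment 0 m) →
  Solution k (when val nᴬ then c otherwise nop) I π̂
solved-without-jobs k c I π̂ = let σ , feasible , opt = proj₁ (proj₂ (opt-exists I)) in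
  4 , input I π̂ , σ , if-false refl skip ,
  ≤-trans (Timing.const-bound {2} ≤-refl 4) (^-monoʳ-≤ 2 {4} (when-degree c)) ,
  (λ ()) , feasible ,
  ≤-trans {k * Cmax I σ} {k * OPT I} (*-monoʳ-≤ k (≤-reflexive opt))
    (m≤m+n (k * OPT I) (2 * PredictionError I π̂))

solved : ∀ k c →
  (∀ {n m} (I : Instance n m) → 1 ≤ n → 1 ≤ m → ∀ π̂ → Solution k (when val nᴬ then c otherwise nop) I π̂) →
  ∀ {n m} (I : Instance n m) (π̂ : Assignment n m) → Solution k (when val nᴬ then c otherwise nop) I π̂
solved k c with-jobs {zero}  I π̂ = solved-without-jobs k c I π̂
solved k c with-jobs {suc _} I π̂ =
  with-jobs I (s≤s z≤n) (≤-trans (s≤s z≤n) (Fin.toℕ<n (π̂ zero))) π̂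

main-solves : ∀ k {n m} (I : Instance n m) (π̂ : Assignment n m) → Solution k (main k) I π̂
main-solves k = solved k (initialise ⨟ guess k) λ I 1≤n 1≤m π̂ → solved-with-jobs I 1≤n 1≤m π̂ k

theorem6 :
    ∃ λ (C : ℕ) →
    ∀ (δ : ℝ) → Unit δ →
    ∃ λ (e : ℕ) → Scaled≤ e δ C ×
    ∃ λ (A : Program) →
    ∀ {n m : ℕ} (I : Instance n m) (π̂ : Assignment n m) →
    ∃ λ (t : ℕ) → ∃ λ (s : Memory) → ∃ λ (σ : Assignment n m) →
      (A , input I π̂ ⇓[ t ] s) ×
      (t ≤ (2 ⊔ n * m) ^ e) ×
      Outputs s σ ×
      Feasible I σ ×
      ≤Affine (Cmax I σ) (OPT I) δ (PredictionError I π̂)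
theorem6 = 6 * (degree (main 0) + 58) , assemble (degree (main 0) + 58) main main-degree main-solves
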